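{- Let $\alpha_k$ be defined by $\alpha_k=q^{6r^2-r}$ if $k=3r-1$, $\alpha_k=q^{6r^2+r}$ if $k=3r$, $\alpha_k=-q^{6r^2+5r+1}-q^{6r^2+7r+2}$ if $k=3r+1$. Then for every integer $p\ge1$, every positive integer $N$ and every primitive $N$th root of unity $q$, $$H_p^{(6)}(q)=\sum_{k=0}^{N-1}(-1)^kq^{\binom{k+1}{2}+(p-1)(k^2+k)}\alpha_k.$$
   Context: $(a)_n=\prod_{k=1}^n(1-aq^{k-1})$, $\begin{bmatrix} n\\ k\end{bmatrix}=\frac{(q)_n}{(q)_{n-k}(q)_k}$. $H_p^{(6)}(q)=\sum_{n_p\ge\cdots\ge n_1\ge0}q^{ -n_p^2}(q^{n_p+1})_{n_p}\prod_{i=1}^{p-1}q^{n_i^2+n_i}\begin{bmatrix} n_{i+1}\\ n_i\end{bmatrix}$; at a root of unity only finitely many terms are nonzero. -}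

module Defs where

open import Level using (Level)
open import Data.Nat using (ℕ; zero; suc; _<_)
import Data.Nat as ℕ
open import Data.Sum using (_⊎_)
open import Relation.Binary.PropositionalEquality using (_≡_)
open import Relation.Nullary using (¬_)
open import Algebra.Bundles using (CommutativeRing)

module _ {c ℓ : Level} (R : CommutativeRing c ℓ) where
  open CommutativeRing R

  pow : Carrier → ℕ → Carrier
  pow x zero    = 1#
  pow x (suc n) = pow x n * x

  ntimes : ℕ → Carrier
  ntimes zero    = 0#
  ntimes (suc n) = 1# + ntimes n

  sumBelow : ℕ → (ℕ → Carrier) → Carrier
  sumBelow zero    f = 0#
  sumBelow (suc n) f = sumBelow n f + f n

  IsIntegralDomain : Set (c Level.⊔ ℓ)
  IsIntegralDomain = ∀ a b → a * b ≈ 0# → a ≈ 0# ⊎ b ≈ 0#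

  CharZero : Set ℓ
  CharZero = ∀ n → ntimes n ≈ 0# → n ≡ 0

  IsPrimitiveRoot : ℕ → Carrier → Set ℓ
  IsPrimitiveRoot N q = pow q N ≈ 1# × (∀ k → 0 < k → k < N → ¬ (pow q k ≈ 1#))
    where open import Data.Product using (_×_)

  module _ (q : Carrier) where
    poch : Carrier → ℕ → Carrier
    poch a zero    = 1#
    poch a (suc n) = poch a n * (1# - a * pow q n)

    -- Gaussian binomial [n k] as a polynomial in q (q-Pascal recurrence)
    qbinom : ℕ → ℕ → Carrier
    qbinom n       zero    = 1#
    qbinom zero    (suc k) = 0#
    qbinom (suc n) (suc k) = qbinom n k + pow q (suc k) * qbinom n (suc k)

    -- G i n = Σ_{n ≥ n_i ≥ ... ≥ n_1 ≥ 0} Π (q^{n_j^2+n_j} [n_{j+1} n_j]) with n_{i+1} = n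
    inner : ℕ → ℕ → Carrier
    inner zero    n = 1#
    inner (suc i) n = sumBelow (suc n) (λ m → pow q (m ℕ.* m ℕ.+ m) * qbinom n m * inner i m)

    -- truncated H_p^{(6)}(q) with n_p < M; qinv is the inverse of q used for q^{-1}
    Htrunc : Carrier → ℕ → ℕ → Carrier
    Htrunc qinv p M =
      sumBelow M (λ n → pow qinv (n ℕ.* n) * poch (pow q (suc n)) n * inner (p ℕ.∸ 1) n)

    alphaRJ : ℕ → ℕ → Carrier
    alphaRJ r zero = pow q (6 ℕ.* r ℕ.* r ℕ.+ r)
    alphaRJ r (suc zero) = - pow q (6 ℕ.* r ℕ.* r ℕ.+ 5 ℕ.* r ℕ.+ 1) - pow q (6 ℕ.* r ℕ.* r ℕ.+ 7 ℕ.* r ℕ.+ 2)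
    alphaRJ r (suc (suc zero)) =                                                   -- k = 3(r+1)-1
      pow q (6 ℕ.* suc r ℕ.* suc r ℕ.∸ suc r)
    alphaRJ r (suc (suc (suc _))) = 0#  -- unreachable (k % 3 < 3)

    alpha : ℕ → Carrier
    alpha k = alphaRJ (k ℕ./ 3) (k ℕ.% 3)

    rhs : ℕ → ℕ → Carrier
    rhs p N = sumBelow N (λ k →
      pow (- 1#) k * pow q ((suc k ℕ.* k) ℕ./ 2 ℕ.+ (p ℕ.∸ 1) ℕ.* (k ℕ.* k ℕ.+ k)) * alpha k)

{-# OPTIONS --safe #-}
-- For 2n < N Bailey's chain, started from the unit pair relative to q, expands
-- (q^{n+1})_n inner_{p-1}(n) as a sum over k ≤ n with weights (-1)^k q^{...} D(k, n-k); for 2n ≥ N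
-- the factor (q^{n+1})_n vanishes.  Summing over n, the k-th column becomes g_k - g_{k+1}, where
-- g_k = Σ_d q^{k^2-(k+d)^2} [2k+2d, d].  As q^N = 1, reflecting the Gaussian binomials turns g_k into
-- Cigler's sum G_n = Σ_d (-1)^d q^{d(d+1)/2} [n-d, d] with n = N-1-2k, and G_{n+1} - G_n = A_{n+2}, where
-- A_{n+3} = -q^{n+1} A_n.  On the other side α_k = A_{2k+1} + A_{2k+2}, the weight is invariant
-- under k ↦ N-1-k, and A_a - A_b + A_{b+N} = 0 whenever a + b = N+1; hence
-- α_k + α_{N-1-k} = A_{n+1} + A_n, and the right-hand side folds onto the columns k < N/2.
module Submission where

-- Bailey pairs carry the denominators (q)_{n-k} (q)_{n+k+1}, which vanish at a root of unity once
-- an index reaches N, and R is a domain without division. A pair is therefore kept multiplied by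
-- (q)_{2n}: its kernel becomes a polynomial, (q)_n β_n is stored in place of β_n, and each step
-- ends by cancelling factors (q)_m with m < N. This works exactly while 2n < N, the range in which
-- the terms of H survive. The parameter p enters only through a factor q^{k^2+k} per step of the
-- chain, common to a whole column. What remains is an identity free of p: the k-th column, cut off
-- at N/2, equals α_k + α_{N-1-k}. The mirror term is an effect of the cut-off. This identity is
-- expressed through A because the sums G have no evident closed form while their differences do:
-- each A_n is 0 or a pentagonal power of q up to sign. Exponents such as nN/2 occur repeatedly;
-- since R may contain no square root of q, they are handled only together with the sign (-1)^n.

open import Defs
open import Level using (Level)
open import Data.Nat using (ℕ; _≤_; _∸_)
open import Data.Nat as ℕ using (zero; suc; _<_; s≤s; z≤n; z<s; s<s; s≤s⁻¹)
import Data.Nat.Properties as ℕₚ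
import Data.Nat.DivMod as ℕ÷
open import Data.Nat.Tactic.RingSolver using () renaming (solve to ℕ-solve)
open import Data.Integer as ℤ using (ℤ; +_; -[1+_])
import Data.Integer.Properties as ℤₚ
open import Data.List using ([]; _∷_)
open import Data.Maybe using (Maybe; just; nothing)
open import Data.Sum using (_⊎_; inj₁; inj₂)
open import Data.Product using (∃; _,_; proj₁; proj₂)
open import Data.Empty using (⊥-elim)
open import Relation.Nullary using (¬_; yes; no)
open import Relation.Binary.PropositionalEquality as ≡ using (_≡_)
open import Algebra.Bundles using (CommutativeRing)
open import Algebra.Solver.Ring.AlmostCommutativeRing using (fromCommutativeRing; _-Raw-AlmostCommutative⟶_)
import Algebra.Solver.Ring
import Algebra.Properties.Ring
import Algebra.Properties.Semiring.Mult.TCOptimised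
import Relation.Binary.Reasoning.Setoid

-- Ring identities with integer coefficients.

module RingSolver {c ℓ : Level} (R : CommutativeRing c ℓ) where
  open CommutativeRing R hiding (zero)
  open Algebra.Properties.Ring ring using (-‿distribˡ-*; -‿distribʳ-*; -0#≈0#; -‿involutive; -‿+-comm)
  open Algebra.Properties.Semiring.Mult.TCOptimised semiring using (_×_; ×-homo-+; ×1-homo-*; 1+×)
  open Relation.Binary.Reasoning.Setoid setoid

  -- Equality in R need not be decidable, so the solver keeps its coefficients in ℤ and compares
  -- them there. With the optimised multiple, `con (+ 0)` and `con (+ 1)` evaluate definitionally to
  -- `0#` and `1#`, so solved equations fit the goals as they stand.
  fromℤ : ℤ → Carrier
  fromℤ (+ n)    = n × 1#
  fromℤ -[1+ n ] = - (suc n × 1#)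

  fromℤ-neg : ∀ i → fromℤ (ℤ.- i) ≈ - fromℤ i
  fromℤ-neg (+ zero)  = sym -0#≈0#
  fromℤ-neg (+ suc n) = refl
  fromℤ-neg -[1+ n ]  = sym (-‿involutive _)

  fromℤ-⊖ : ∀ m n → fromℤ (m ℤ.⊖ n) ≈ m × 1# - n × 1#
  fromℤ-⊖ zero zero = sym (trans (+-congˡ -0#≈0#) (+-identityʳ _))
  fromℤ-⊖ zero (suc n) = sym (+-identityˡ _)
  fromℤ-⊖ (suc m) zero = sym (trans (+-congˡ -0#≈0#) (+-identityʳ _))
  fromℤ-⊖ (suc m) (suc n) = begin
    fromℤ (suc m ℤ.⊖ suc n)                 ≈⟨ reflexive (≡.cong fromℤ (ℤₚ.[1+m]⊖[1+n]≡m⊖n m n)) ⟩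
    fromℤ (m ℤ.⊖ n)                         ≈⟨ fromℤ-⊖ m n ⟩
    m × 1# - n × 1#                         ≈⟨ +-congʳ (+-identityʳ _) ⟨
    (m × 1# + 0#) - n × 1#                  ≈⟨ +-congʳ (+-congˡ (-‿inverseʳ 1#)) ⟨
    (m × 1# + (1# - 1#)) - n × 1#           ≈⟨ +-congʳ (+-assoc _ _ _) ⟨
    ((m × 1# + 1#) - 1#) - n × 1#           ≈⟨ +-assoc _ _ _ ⟩
    (m × 1# + 1#) + (- 1# - n × 1#)         ≈⟨ +-cong (+-comm _ _) (-‿+-comm _ _) ⟩
    (1# + m × 1#) - (1# + n × 1#)           ≈⟨ +-cong (1+× m 1#) (-‿cong (1+× n 1#)) ⟨
    suc m × 1# - suc n × 1#                 ∎

  fromℤ-+ : ∀ i j → fromℤ (i ℤ.+ j) ≈ fromℤ i + fromℤ j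
  fromℤ-+ (+ m)    (+ n)    = ×-homo-+ 1# m n
  fromℤ-+ (+ m)    -[1+ n ] = fromℤ-⊖ m (suc n)
  fromℤ-+ -[1+ m ] (+ n)    = trans (fromℤ-⊖ n (suc m)) (+-comm _ _)
  fromℤ-+ -[1+ m ] -[1+ n ] = begin
    fromℤ (-[1+ m ] ℤ.+ -[1+ n ])            ≈⟨ reflexive (≡.cong fromℤ (ℤₚ.neg-distrib-+ (+ suc m) (+ suc n))) ⟨
    fromℤ (ℤ.- (+ suc m ℤ.+ + suc n))        ≈⟨ fromℤ-neg (+ suc m ℤ.+ + suc n) ⟩
    - (fromℤ (+ suc m ℤ.+ + suc n))          ≈⟨ -‿cong (×-homo-+ 1# (suc m) (suc n)) ⟩
    - (suc m × 1# + suc n × 1#)              ≈⟨ -‿+-comm _ _ ⟨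
    - (suc m × 1#) - suc n × 1#              ∎

  fromℤ-+* : ∀ m j → fromℤ (+ m ℤ.* j) ≈ m × 1# * fromℤ j
  fromℤ-+* m (+ n) = begin
    fromℤ (+ m ℤ.* + n)      ≈⟨ reflexive (≡.cong fromℤ (ℤₚ.pos-* m n)) ⟨
    (m ℕ.* n) × 1#           ≈⟨ ×1-homo-* m n ⟩
    m × 1# * n × 1#          ∎
  fromℤ-+* m -[1+ n ] = begin
    fromℤ (+ m ℤ.* -[1+ n ])         ≈⟨ reflexive (≡.cong fromℤ (ℤₚ.neg-distribʳ-* (+ m) (+ suc n))) ⟨
    fromℤ (ℤ.- (+ m ℤ.* + suc n))    ≈⟨ fromℤ-neg (+ m ℤ.* + suc n) ⟩
    - fromℤ (+ m ℤ.* + suc n)        ≈⟨ -‿cong (fromℤ-+* m (+ suc n)) ⟩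
    - (m × 1# * suc n × 1#)          ≈⟨ -‿distribʳ-* _ _ ⟩
    m × 1# * - (suc n × 1#)          ∎

  fromℤ-* : ∀ i j → fromℤ (i ℤ.* j) ≈ fromℤ i * fromℤ j
  fromℤ-* (+ m)    j = fromℤ-+* m j
  fromℤ-* -[1+ m ] j = begin
    fromℤ (-[1+ m ] ℤ.* j)           ≈⟨ reflexive (≡.cong fromℤ (ℤₚ.neg-distribˡ-* (+ suc m) j)) ⟨
    fromℤ (ℤ.- (+ suc m ℤ.* j))      ≈⟨ fromℤ-neg (+ suc m ℤ.* j) ⟩
    - fromℤ (+ suc m ℤ.* j)          ≈⟨ -‿cong (fromℤ-+* (suc m) j) ⟩
    - (suc m × 1# * fromℤ j)         ≈⟨ -‿distribˡ-* _ _ ⟩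
    - (suc m × 1#) * fromℤ j         ∎

  morphism : ℤ.+-*-rawRing -Raw-AlmostCommutative⟶ fromCommutativeRing R
  morphism = record
    { ⟦_⟧    = fromℤ
    ; +-homo = fromℤ-+
    ; *-homo = fromℤ-*
    ; -‿homo = fromℤ-neg
    ; 0-homo = refl
    ; 1-homo = refl
    }

  coeff≟ : ∀ i j → Maybe (fromℤ i ≈ fromℤ j)
  coeff≟ i j with i ℤ.≟ j
  ... | yes i≡j = just (reflexive (≡.cong fromℤ i≡j))
  ... | no  _   = nothing

  open Algebra.Solver.Ring ℤ.+-*-rawRing (fromCommutativeRing R) morphism coeff≟ public
    using (solve; _:=_; _:+_; _:*_; _:-_; :-_; con)

-- Finite sums.

module Sums {c ℓ : Level} (R : CommutativeRing c ℓ) where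
  open CommutativeRing R hiding (zero)
  open RingSolver R
  open Relation.Binary.Reasoning.Setoid setoid

  sum : ℕ → (ℕ → Carrier) → Carrier
  sum = sumBelow R

  sum-cong : ∀ n {f g : ℕ → Carrier} → (∀ i → i < n → f i ≈ g i) → sum n f ≈ sum n g
  sum-cong zero    f≈g = refl
  sum-cong (suc n) f≈g =
    +-cong (sum-cong n (λ i i<n → f≈g i (ℕₚ.m<n⇒m<1+n i<n))) (f≈g n (ℕₚ.n<1+n n))

  sum-0 : ∀ n → sum n (λ _ → 0#) ≈ 0#
  sum-0 zero    = refl
  sum-0 (suc n) = trans (+-identityʳ _) (sum-0 n)

  sum-zero : ∀ n {f : ℕ → Carrier} → (∀ i → i < n → f i ≈ 0#) → sum n f ≈ 0#
  sum-zero n f≈0 = trans (sum-cong n f≈0) (sum-0 n)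

  sum-+ : ∀ n (f g : ℕ → Carrier) → sum n (λ i → f i + g i) ≈ sum n f + sum n g
  sum-+ zero    f g = sym (+-identityˡ 0#)
  sum-+ (suc n) f g = trans (+-congʳ (sum-+ n f g))
    (solve 4 (λ a b x y → (a :+ b) :+ (x :+ y) := (a :+ x) :+ (b :+ y)) refl _ _ _ _)

  sum-- : ∀ n (f g : ℕ → Carrier) → sum n (λ i → f i - g i) ≈ sum n f - sum n g
  sum-- zero    f g = sym (-‿inverseʳ 0#)
  sum-- (suc n) f g = trans (+-congʳ (sum-- n f g))
    (solve 4 (λ a b x y → (a :- b) :+ (x :- y) := (a :+ x) :- (b :+ y)) refl _ _ _ _)

  *-sum : ∀ n x (f : ℕ → Carrier) → x * sum n f ≈ sum n (λ i → x * f i)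
  *-sum zero    x f = zeroʳ x
  *-sum (suc n) x f = trans (distribˡ _ _ _) (+-congʳ (*-sum n x f))

  sum-head : ∀ n (f : ℕ → Carrier) → sum (suc n) f ≈ f 0 + sum n (λ i → f (suc i))
  sum-head zero    f = +-comm _ _
  sum-head (suc n) f = trans (+-congʳ (sum-head n f)) (+-assoc _ _ _)

  sum-split : ∀ m n (f : ℕ → Carrier) → sum (m ℕ.+ n) f ≈ sum m f + sum n (λ i → f (m ℕ.+ i))
  sum-split zero    n f = sym (+-identityˡ _)
  sum-split (suc m) n f = begin
    sum (suc (m ℕ.+ n)) f                                            ≈⟨ sum-head (m ℕ.+ n) f ⟩
    f 0 + sum (m ℕ.+ n) (λ i → f (suc i))                            ≈⟨ +-congˡ (sum-split m n _) ⟩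
    f 0 + (sum m (λ i → f (suc i)) + sum n (λ i → f (suc (m ℕ.+ i)))) ≈⟨ +-assoc _ _ _ ⟨
    (f 0 + sum m (λ i → f (suc i))) + sum n (λ i → f (suc (m ℕ.+ i))) ≈⟨ +-congʳ (sum-head m f) ⟨
    sum (suc m) f + sum n (λ i → f (suc m ℕ.+ i))                    ∎

  sum-extend : ∀ {m n} (f : ℕ → Carrier) → m ≤ n → (∀ i → m ≤ i → f i ≈ 0#) → sum n f ≈ sum m f
  sum-extend {m} {n} f m≤n f≈0 = begin
    sum n f                                           ≡⟨ ≡.cong (λ l → sum l f) (ℕₚ.m+[n∸m]≡n m≤n) ⟨
    sum (m ℕ.+ (n ∸ m)) f                             ≈⟨ sum-split m (n ∸ m) f ⟩
    sum m f + sum (n ∸ m) (λ i → f (m ℕ.+ i))         ≈⟨ +-congˡ (sum-zero (n ∸ m) (λ i _ → f≈0 _ (ℕₚ.m≤m+n m i))) ⟩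
    sum m f + 0#                                      ≈⟨ +-identityʳ _ ⟩
    sum m f                                           ∎

  sum-reverse : ∀ n (f : ℕ → Carrier) → sum n f ≈ sum n (λ i → f (n ∸ suc i))
  sum-reverse zero    f = refl
  sum-reverse (suc n) f = begin
    sum n f + f n                                ≈⟨ +-comm _ _ ⟩
    f n + sum n f                                ≈⟨ +-congˡ (sum-reverse n f) ⟩
    f n + sum n (λ i → f (n ∸ suc i))            ≈⟨ sum-head n (λ i → f (n ∸ i)) ⟨
    sum (suc n) (λ i → f (n ∸ i))                ∎

  -- A new row n adds to each column k ≤ n exactly one entry, the one with d = n ∸ k. Indexing
  -- columns by d rather than by m is what later makes each of them a sum starting at 0.
  sum-triangle : ∀ n (F : ℕ → ℕ → Carrier) →
    sum n (λ m → sum (suc m) (λ k → F k (m ∸ k))) ≈ sum n (λ k → sum (n ∸ k) (F k))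
  sum-triangle zero    F = refl
  sum-triangle (suc n) F = begin
    sum n (λ m → sum (suc m) (λ k → F k (m ∸ k))) + sum (suc n) (λ k → F k (n ∸ k))
      ≈⟨ +-congʳ (sum-triangle n F) ⟩
    sum n (λ k → sum (n ∸ k) (F k)) + (sum n (λ k → F k (n ∸ k)) + F n (n ∸ n))
      ≈⟨ +-assoc _ _ _ ⟨
    (sum n (λ k → sum (n ∸ k) (F k)) + sum n (λ k → F k (n ∸ k))) + F n (n ∸ n)
      ≈⟨ +-cong (trans (sym (sum-+ n _ _)) (sum-cong n (λ k k<n → sym (step k (ℕₚ.<⇒≤ k<n))))) last ⟩
    sum n (λ k → sum (suc n ∸ k) (F k)) + sum (suc n ∸ n) (F n) ∎
    where
    step : ∀ k → k ≤ n → sum (suc n ∸ k) (F k) ≈ sum (n ∸ k) (F k) + F k (n ∸ k)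
    step k k≤n = reflexive (≡.cong (λ l → sum l (F k)) (ℕₚ.+-∸-assoc 1 k≤n))
    last : F n (n ∸ n) ≈ sum (suc n ∸ n) (F n)
    last = begin
      F n (n ∸ n)                          ≈⟨ +-identityˡ _ ⟨
      0# + F n (n ∸ n)                     ≡⟨ ≡.cong (λ l → sum l (F n) + F n (n ∸ n)) (ℕₚ.n∸n≡0 n) ⟨
      sum (n ∸ n) (F n) + F n (n ∸ n)      ≈⟨ step n ℕₚ.≤-refl ⟨
      sum (suc n ∸ n) (F n)                ∎

-- q-shifted factorials and Gaussian binomials over an arbitrary commutative ring.

module QSeries {c ℓ : Level} (R : CommutativeRing c ℓ) (q : CommutativeRing.Carrier R) where
  open CommutativeRing R hiding (zero)
  open RingSolver R
  open Sums R
  open Relation.Binary.Reasoning.Setoid setoid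

  pow-+ : ∀ x m n → pow R x (m ℕ.+ n) ≈ pow R x m * pow R x n
  pow-+ x zero    n = sym (*-identityˡ _)
  pow-+ x (suc m) n = trans (*-congʳ (pow-+ x m n))
    (solve 3 (λ a b x → (a :* b) :* x := (a :* x) :* b) refl _ _ _)

  pow-cong : ∀ n {x y} → x ≈ y → pow R x n ≈ pow R y n
  pow-cong zero    x≈y = refl
  pow-cong (suc n) x≈y = *-cong (pow-cong n x≈y) x≈y

  pow-1 : ∀ n → pow R 1# n ≈ 1#
  pow-1 zero    = refl
  pow-1 (suc n) = trans (*-identityʳ _) (pow-1 n)

  pow-* : ∀ x m n → pow R x (m ℕ.* n) ≈ pow R (pow R x n) m
  pow-* x zero    n = refl
  pow-* x (suc m) n = trans (pow-+ x n (m ℕ.* n)) (trans (*-comm _ _) (*-congʳ (pow-* x m n)))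

  q^ : ℕ → Carrier
  q^ = pow R q

  q^-≡ : ∀ {m n} → m ≡ n → q^ m ≈ q^ n
  q^-≡ m≡n = reflexive (≡.cong q^ m≡n)

  q^-*₂ : ∀ a b {n} → a ℕ.+ b ≡ n → q^ a * q^ b ≈ q^ n
  q^-*₂ a b eq = trans (sym (pow-+ q a b)) (q^-≡ eq)

  q^-*₃ : ∀ a b c {n} → a ℕ.+ b ℕ.+ c ≡ n → q^ a * q^ b * q^ c ≈ q^ n
  q^-*₃ a b c eq = trans (*-congʳ (q^-*₂ a b ≡.refl)) (q^-*₂ (a ℕ.+ b) c eq)

  sg : ℕ → Carrier
  sg = pow R (- 1#)

  P : ℕ → ℕ → Carrier
  P a n = poch R q (q^ a) n

  binom : ℕ → ℕ → Carrier
  binom = qbinom R q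

  P-last : ∀ a n → P a (suc n) ≈ P a n * (1# - q^ (a ℕ.+ n))
  P-last a n = *-congˡ (+-congˡ (-‿cong (sym (pow-+ q a n))))

  P-head : ∀ a n → P a (suc n) ≈ (1# - q^ a) * P (suc a) n
  P-head a zero    = solve 1 (λ x → con (+ 1) :* (con (+ 1) :- x :* con (+ 1)) := (con (+ 1) :- x) :* con (+ 1)) refl _
  P-head a (suc n) = trans (*-congʳ (P-head a n))
    (solve 4 (λ x p l q → ((con (+ 1) :- x) :* p) :* (con (+ 1) :- x :* (l :* q))
       := (con (+ 1) :- x) :* (p :* (con (+ 1) :- (x :* q) :* l))) refl _ _ _ _)

  P-+ : ∀ a m n → P a (m ℕ.+ n) ≈ P a m * P (a ℕ.+ m) n
  P-+ a m zero    = trans (reflexive (≡.cong (P a) (ℕₚ.+-identityʳ m))) (sym (*-identityʳ _))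
  P-+ a m (suc n) = begin
    P a (m ℕ.+ suc n)                                        ≡⟨ ≡.cong (P a) (ℕₚ.+-suc m n) ⟩
    P a (suc (m ℕ.+ n))                                      ≈⟨ P-last a (m ℕ.+ n) ⟩
    P a (m ℕ.+ n) * (1# - q^ (a ℕ.+ (m ℕ.+ n)))              ≈⟨ *-cong (P-+ a m n) (+-congˡ (-‿cong (q^-≡ (≡.sym (ℕₚ.+-assoc a m n))))) ⟩
    P a m * P (a ℕ.+ m) n * (1# - q^ (a ℕ.+ m ℕ.+ n))        ≈⟨ *-assoc _ _ _ ⟩
    P a m * (P (a ℕ.+ m) n * (1# - q^ (a ℕ.+ m ℕ.+ n)))      ≈⟨ *-congˡ (P-last (a ℕ.+ m) n) ⟨
    P a m * P (a ℕ.+ m) (suc n)                              ∎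

  P-vanish : ∀ a n i → i < n → q^ (a ℕ.+ i) ≈ 1# → P a n ≈ 0#
  P-vanish a (suc n) i i<1+n root with i ℕ.≟ n
  ... | yes ≡.refl = begin
    P a (suc n)                         ≈⟨ P-last a n ⟩
    P a n * (1# - q^ (a ℕ.+ n))         ≈⟨ *-congˡ (trans (+-congˡ (-‿cong root)) (-‿inverseʳ 1#)) ⟩
    P a n * 0#                          ≈⟨ zeroʳ _ ⟩
    0#                                  ∎
  ... | no i≢n = trans (*-congʳ (P-vanish a n i (ℕₚ.≤∧≢⇒< (s≤s⁻¹ i<1+n) i≢n) root)) (zeroˡ _)

  φ : ℕ → Carrier
  φ n = P 1 n

  φ-suc : ∀ n → φ (suc n) ≈ φ n * (1# - q^ (suc n))
  φ-suc n = P-last 1 n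

  binom-zero : ∀ n k → n < k → binom n k ≈ 0#
  binom-zero zero    (suc k) _   = refl
  binom-zero (suc n) (suc k) n<k = begin
    binom n k + q^ (suc k) * binom n (suc k)   ≈⟨ +-cong (binom-zero n k (s≤s⁻¹ n<k)) (*-congˡ (binom-zero n (suc k) (ℕₚ.m<n⇒m<1+n (s≤s⁻¹ n<k)))) ⟩
    0# + q^ (suc k) * 0#                       ≈⟨ trans (+-identityˡ _) (zeroʳ _) ⟩
    0#                                         ∎

  binom-self : ∀ n → binom n n ≈ 1#
  binom-self zero    = refl
  binom-self (suc n) = begin
    binom n n + q^ (suc n) * binom n (suc n)   ≈⟨ +-cong (binom-self n) (*-congˡ (binom-zero n (suc n) (ℕₚ.n<1+n n))) ⟩
    1# + q^ (suc n) * 0#                       ≈⟨ trans (+-congˡ (zeroʳ _)) (+-identityʳ _) ⟩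
    1#                                         ∎

  -- The quotient formula for [k+e, k] with its denominators multiplied out, so it holds even where
  -- (q)_k vanishes. The Pascal rule reduces it to (1 - x) + x(1 - y) = 1 - xy with x = q^{k+1}, y =
  -- q^{e+1}.
  binom-φ : ∀ k e → binom (k ℕ.+ e) k * φ k * φ e ≈ φ (k ℕ.+ e)
  binom-φ zero    e       = trans (*-congʳ (*-identityʳ _)) (*-identityˡ _)
  binom-φ (suc k) zero    = begin
    binom (suc k ℕ.+ 0) (suc k) * φ (suc k) * 1#
      ≡⟨ ≡.cong (λ n → binom n (suc k) * φ (suc k) * 1#) (ℕₚ.+-identityʳ (suc k)) ⟩
    binom (suc k) (suc k) * φ (suc k) * 1#    ≈⟨ trans (*-identityʳ _) (*-congʳ (binom-self (suc k))) ⟩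
    1# * φ (suc k)                            ≈⟨ *-identityˡ _ ⟩
    φ (suc k)                                 ≡⟨ ≡.cong φ (ℕₚ.+-identityʳ (suc k)) ⟨
    φ (suc k ℕ.+ 0)                           ∎
  binom-φ (suc k) (suc e) = begin
    (binom n k + q^ (suc k) * binom n (suc k)) * φ (suc k) * φ (suc e)
      ≈⟨ *-cong (*-congˡ (φ-suc k)) (φ-suc e) ⟩
    (binom n k + x * binom n (suc k)) * (φ k * (1# - x)) * (φ e * (1# - y))
      ≈⟨ solve 6 (λ B C f g x y → (B :+ x :* C) :* (f :* (con (+ 1) :- x)) :* (g :* (con (+ 1) :- y))
           := (B :* f :* (g :* (con (+ 1) :- y))) :* (con (+ 1) :- x) :+ (C :* (f :* (con (+ 1) :- x)) :* g) :* (x :* (con (+ 1) :- y)))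
           refl _ _ _ _ _ _ ⟩
    binom n k * φ k * (φ e * (1# - y)) * (1# - x) + binom n (suc k) * (φ k * (1# - x)) * φ e * (x * (1# - y))
      ≈⟨ +-cong (*-congʳ (trans (*-congˡ (sym (φ-suc e))) (binom-φ k (suc e))))
                (*-congʳ (trans (*-congʳ (*-congˡ (sym (φ-suc k)))) IH₂)) ⟩
    φ n * (1# - x) + φ n * (x * (1# - y))
      ≈⟨ solve 3 (λ F x y → F :* (con (+ 1) :- x) :+ F :* (x :* (con (+ 1) :- y)) := F :* (con (+ 1) :- x :* y)) refl _ _ _ ⟩
    φ n * (1# - x * y)
      ≈⟨ *-congˡ (+-congˡ (-‿cong (q^-*₂ (suc k) (suc e) ≡.refl))) ⟩
    φ n * (1# - q^ (suc n))
      ≈⟨ φ-suc n ⟨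
    φ (suc n) ∎
    where
    n = k ℕ.+ suc e
    x = q^ (suc k)
    y = q^ (suc e)
    IH₂ : binom n (suc k) * φ (suc k) * φ e ≈ φ n
    IH₂ = ≡.subst (λ m → binom m (suc k) * φ (suc k) * φ e ≈ φ m) (≡.sym (ℕₚ.+-suc k e)) (binom-φ (suc k) e)

  -- Truncation makes k + (n ∸ k) differ from n when k > n, but there the binomial factor is zero.
  binom-q^∸ : ∀ n k → binom n k * q^ (k ℕ.+ (n ∸ k)) ≈ binom n k * q^ n
  binom-q^∸ n k with k ℕ.≤? n
  ... | yes k≤n = *-congˡ (q^-≡ (ℕₚ.m+[n∸m]≡n k≤n))
  ... | no  k≰n = trans (*-congʳ zero!) (trans (zeroˡ _) (sym (trans (*-congʳ zero!) (zeroˡ _))))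
    where zero! = binom-zero n k (ℕₚ.≰⇒> k≰n)

  mutual
    -- The ratio of neighbouring Gaussian binomials, free of division. Cancelling in `binom-φ` would
    -- require nonzero (q)_n; instead absorption in row n yields, by the Pascal rule, the form
    -- `binom-absorb′` for row n + 1, and this in turn yields absorption in row n + 1.
    binom-absorb : ∀ n k → binom n (suc k) * (1# - q^ (suc k)) ≈ binom n k * (1# - q^ (n ∸ k))
    binom-absorb zero    zero    = trans (zeroˡ _) (sym (trans (*-identityˡ _) (-‿inverseʳ 1#)))
    binom-absorb zero    (suc k) = trans (zeroˡ _) (sym (zeroˡ _))
    binom-absorb (suc n) zero    = binom-absorb′ n zero
    binom-absorb (suc n) (suc k) = begin
      binom (suc n) (suc (suc k)) * (1# - q^ (suc (suc k)))     ≈⟨ binom-absorb′ n (suc k) ⟩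
      C * (1# - q^ (suc n))                                     ≈⟨ solve 2 (λ C y → C :* (con (+ 1) :- y) := C :- C :* y) refl _ _ ⟩
      C - C * q^ (suc n)                                        ≈⟨ +-congˡ (-‿cong shift) ⟨
      C - C * (x * z)                                           ≈⟨ solve 3 (λ C x z → C :- C :* (x :* z) := C :* (con (+ 1) :- x) :+ x :* C :* (con (+ 1) :- z)) refl _ _ _ ⟩
      C * (1# - x) + x * C * (1# - z)                           ≈⟨ +-congʳ (binom-absorb n k) ⟩
      binom n k * (1# - z) + x * C * (1# - z)                   ≈⟨ distribʳ _ _ _ ⟨
      (binom n k + x * C) * (1# - z)                            ∎
      where
      C = binom n (suc k)
      x = q^ (suc k)
      z = q^ (n ∸ k)
      shift : C * (x * z) ≈ C * q^ (suc n)
      shift with k ℕ.<? n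
      ... | yes k<n = *-congˡ (q^-*₂ (suc k) (n ∸ k) (≡.cong suc (ℕₚ.m+[n∸m]≡n (ℕₚ.<⇒≤ k<n))))
      ... | no  k≮n = trans (*-congʳ zero!) (trans (zeroˡ _) (sym (trans (*-congʳ zero!) (zeroˡ _))))
        where zero! = binom-zero n (suc k) (s≤s (ℕₚ.≮⇒≥ k≮n))

    binom-absorb′ : ∀ n k → binom (suc n) (suc k) * (1# - q^ (suc k)) ≈ binom n k * (1# - q^ (suc n))
    binom-absorb′ n k = begin
      (B + x * binom n (suc k)) * (1# - x)              ≈⟨ solve 3 (λ B x C → (B :+ x :* C) :* (con (+ 1) :- x) := B :* (con (+ 1) :- x) :+ x :* (C :* (con (+ 1) :- x))) refl _ _ _ ⟩
      B * (1# - x) + x * (binom n (suc k) * (1# - x))   ≈⟨ +-congˡ (*-congˡ (binom-absorb n k)) ⟩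
      B * (1# - x) + x * (B * (1# - q^ (n ∸ k)))        ≈⟨ solve 3 (λ B x z → B :* (con (+ 1) :- x) :+ x :* (B :* (con (+ 1) :- z)) := B :- B :* (x :* z)) refl _ _ _ ⟩
      B - B * (x * q^ (n ∸ k))                          ≈⟨ +-congˡ (-‿cong shift) ⟩
      B - B * q^ (suc n)                                ≈⟨ solve 2 (λ C y → C :- C :* y := C :* (con (+ 1) :- y)) refl _ _ ⟩
      B * (1# - q^ (suc n))                             ∎
      where
      B = binom n k
      x = q^ (suc k)
      shift : B * (x * q^ (n ∸ k)) ≈ B * q^ (suc n)
      shift = begin
        B * (x * q^ (n ∸ k))              ≈⟨ *-congˡ (q^-*₂ (suc k) (n ∸ k) ≡.refl) ⟩
        B * (q^ (k ℕ.+ (n ∸ k)) * q)      ≈⟨ *-assoc _ _ _ ⟨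
        B * q^ (k ℕ.+ (n ∸ k)) * q        ≈⟨ *-congʳ (binom-q^∸ n k) ⟩
        B * q^ n * q                      ≈⟨ *-assoc _ _ _ ⟩
        B * q^ (suc n)                    ∎

  -- The second q-Pascal rule: by absorption it agrees with the defining one.
  binom-pascal : ∀ n k → binom (suc n) (suc k) ≈ q^ (n ∸ k) * binom n k + binom n (suc k)
  binom-pascal n k = begin
    B + x * C                      ≈⟨ solve 3 (λ B x C → B :+ x :* C := (B :+ C) :- C :* (con (+ 1) :- x)) refl _ _ _ ⟩
    (B + C) - C * (1# - x)         ≈⟨ +-congˡ (-‿cong (binom-absorb n k)) ⟩
    (B + C) - B * (1# - z)         ≈⟨ solve 3 (λ B C z → (B :+ C) :- B :* (con (+ 1) :- z) := z :* B :+ C) refl _ _ _ ⟩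
    z * B + C                      ∎
    where
    B = binom n k
    C = binom n (suc k)
    x = q^ (suc k)
    z = q^ (n ∸ k)

-- The triangular number k(k-1)/2, by recursion to avoid halving. The exponent written with a
-- quotient by 2 in `rhs` is `tri (suc k)`; see `tri-/2`.
tri : ℕ → ℕ
tri zero    = 0
tri (suc k) = tri k ℕ.+ k

-- The Bailey kernel relative to q, with denominators cleared.

module BaileyPairs {c ℓ : Level} (R : CommutativeRing c ℓ) (q : CommutativeRing.Carrier R) where
  open CommutativeRing R hiding (zero)
  open RingSolver R
  open Sums R
  open QSeries R q
  open Relation.Binary.Reasoning.Setoid setoid

  -- A case of q-Chu–Vandermonde. The q-Pascal rule splits the sum for (L + 1, c) into two sums whose
  -- j-th terms add up to the j-th term for (L, c + 1).
  vandermonde : ∀ L c →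
    sum (suc L) (λ j → q^ (j ℕ.* j ℕ.+ c ℕ.* j) * binom L j * P (suc (c ℕ.+ j)) (L ∸ j)) ≈ 1#
  vandermonde zero c = begin
    0# + q^ (c ℕ.* 0) * 1# * 1#     ≈⟨ solve 1 (λ x → con (+ 0) :+ x :* con (+ 1) :* con (+ 1) := x) refl _ ⟩
    q^ (c ℕ.* 0)                    ≈⟨ q^-≡ (ℕₚ.*-zeroʳ c) ⟩
    1#                              ∎
  vandermonde (suc L) c = begin
    sum (suc (suc L)) T                                    ≈⟨ sum-head (suc L) T ⟩
    T 0 + sum (suc L) (λ j → T (suc j))                    ≈⟨ +-cong T-0 (sum-cong (suc L) (λ j _ → T-suc j)) ⟩
    U 0 + sum (suc L) (λ j → V j + U (suc j))              ≈⟨ +-congˡ (trans (sum-+ (suc L) V (λ j → U (suc j))) (+-comm _ _)) ⟩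
    U 0 + (sum (suc L) (λ j → U (suc j)) + sum (suc L) V)  ≈⟨ +-assoc _ _ _ ⟨
    U 0 + sum (suc L) (λ j → U (suc j)) + sum (suc L) V    ≈⟨ +-congʳ (sum-head (suc L) U) ⟨
    sum (suc (suc L)) U + sum (suc L) V                    ≈⟨ +-congʳ (trans (+-congˡ U-end) (+-identityʳ _)) ⟩
    sum (suc L) U + sum (suc L) V                          ≈⟨ sum-+ (suc L) U V ⟨
    sum (suc L) (λ j → U j + V j)                          ≈⟨ sum-cong (suc L) (λ j j<1+L → U+V j (s≤s⁻¹ j<1+L)) ⟩
    sum (suc L) T′                                         ≈⟨ vandermonde L (suc c) ⟩
    1# ∎
    where
    T T′ U V : ℕ → Carrier
    T j = q^ (j ℕ.* j ℕ.+ c ℕ.* j) * binom (suc L) j * P (suc (c ℕ.+ j)) (suc L ∸ j)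
    T′ j = q^ (j ℕ.* j ℕ.+ suc c ℕ.* j) * binom L j * P (suc (suc c ℕ.+ j)) (L ∸ j)
    U j = q^ (j ℕ.* j ℕ.+ c ℕ.* j) * (q^ j * binom L j) * P (suc (c ℕ.+ j)) (suc L ∸ j)
    V j = q^ (suc j ℕ.* suc j ℕ.+ c ℕ.* suc j) * binom L j * P (suc (c ℕ.+ suc j)) (L ∸ j)

    T-0 : T 0 ≈ U 0
    T-0 = *-congʳ (*-congˡ (sym (*-identityˡ 1#)))

    T-suc : ∀ j → T (suc j) ≈ V j + U (suc j)
    T-suc j = solve 4 (λ x b b′ p → x :* (b :+ b′) :* p := x :* b :* p :+ x :* b′ :* p) refl _ _ _ _

    U-end : U (suc L) ≈ 0#
    U-end = begin
      U (suc L)  ≈⟨ *-congʳ (*-congˡ (*-congˡ (binom-zero L (suc L) (ℕₚ.n<1+n L)))) ⟩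
      _          ≈⟨ solve 3 (λ x y p → x :* (y :* con (+ 0)) :* p := con (+ 0)) refl _ _ _ ⟩
      0#         ∎

    U+V : ∀ j → j ≤ L → U j + V j ≈ T′ j
    U+V j j≤L = begin
      U j + V j
        ≈⟨ +-cong (*-congˡ P-expand) (*-cong (*-congʳ q^-V) (reflexive (≡.cong (λ a → P (suc a) (L ∸ j)) (ℕₚ.+-suc c j)))) ⟩
      x * (y * B) * ((1# - z) * p) + x * y * z * B * p
        ≈⟨ solve 5 (λ x y z B p → x :* (y :* B) :* ((con (+ 1) :- z) :* p) :+ x :* y :* z :* B :* p := x :* y :* B :* p) refl _ _ _ _ _ ⟩
      x * y * B * p
        ≈⟨ *-congʳ (*-congʳ (q^-*₂ (j ℕ.* j ℕ.+ c ℕ.* j) j {j ℕ.* j ℕ.+ suc c ℕ.* j} (ℕ-solve (c ∷ j ∷ [])))) ⟩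
      T′ j ∎
      where
      x = q^ (j ℕ.* j ℕ.+ c ℕ.* j)
      y = q^ j
      z = q^ (suc (c ℕ.+ j))
      B = binom L j
      p = P (suc (suc (c ℕ.+ j))) (L ∸ j)
      P-expand : P (suc (c ℕ.+ j)) (suc L ∸ j) ≈ (1# - z) * p
      P-expand = trans (reflexive (≡.cong (P (suc (c ℕ.+ j))) (ℕₚ.+-∸-assoc 1 j≤L))) (P-head (suc (c ℕ.+ j)) (L ∸ j))
      q^-V : q^ (suc j ℕ.* suc j ℕ.+ c ℕ.* suc j) ≈ x * y * z
      q^-V = sym (q^-*₃ (j ℕ.* j ℕ.+ c ℕ.* j) j (suc (c ℕ.+ j)) {suc j ℕ.* suc j ℕ.+ c ℕ.* suc j} (ℕ-solve (c ∷ j ∷ [])))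

  φ-double : ∀ n → φ (2 ℕ.* n) ≈ φ n * P (suc n) n
  φ-double n = trans (reflexive (≡.cong (λ m → φ (n ℕ.+ m)) (ℕₚ.+-identityʳ n))) (P-+ 1 n n)

  binomPred : ℕ → ℕ → Carrier
  binomPred n zero    = 0#
  binomPred n (suc k) = binom n k

  -- With m = k + d this is (q)_{2m} (1 - q^{2k+1}) / ((q)_{m-k} (q)_{m+k+1}), the kernel of a
  -- Bailey pair relative to q with the denominator (q)_{2m} cleared; see D-φ.
  D : ℕ → ℕ → Carrier
  D k d = binom (2 ℕ.* (k ℕ.+ d)) d - q^ (suc (2 ℕ.* k)) * binomPred (2 ℕ.* (k ℕ.+ d)) d

  D-zero : ∀ k → D k 0 ≈ 1#
  D-zero k = solve 1 (λ x → con (+ 1) :- x :* con (+ 0) := con (+ 1)) refl _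

  -- Once `binom-φ` has turned both binomials into (q)_{2(k+d)}, the claim is (1 - xy) - x(1 - y) =
  -- 1 - x with x = q^{2k+1}, y = q^d.
  D-φ : ∀ k d → φ d * φ (suc (2 ℕ.* k ℕ.+ d)) * D k d ≈ φ (2 ℕ.* (k ℕ.+ d)) * (1# - q^ (suc (2 ℕ.* k)))
  D-φ k zero = begin
    1# * φ (suc (2 ℕ.* k ℕ.+ 0)) * D k 0        ≈⟨ *-cong (*-identityˡ _) (D-zero k) ⟩
    φ (suc (2 ℕ.* k ℕ.+ 0)) * 1#                ≈⟨ *-identityʳ _ ⟩
    φ (suc (2 ℕ.* k ℕ.+ 0))                     ≡⟨ ≡.cong (λ n → φ (suc n)) (ℕₚ.+-identityʳ (2 ℕ.* k)) ⟩
    φ (suc (2 ℕ.* k))                           ≈⟨ φ-suc (2 ℕ.* k) ⟩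
    φ (2 ℕ.* k) * (1# - q^ (suc (2 ℕ.* k)))     ≡⟨ ≡.cong (λ n → φ (2 ℕ.* n) * (1# - q^ (suc (2 ℕ.* k)))) (ℕₚ.+-identityʳ k) ⟨
    φ (2 ℕ.* (k ℕ.+ 0)) * (1# - q^ (suc (2 ℕ.* k))) ∎
  D-φ k (suc e) = begin
    φ (suc e) * φ (suc t) * (B - x * C)
      ≈⟨ solve 5 (λ f g B x C → f :* g :* (B :- x :* C) := B :* f :* g :- x :* (C :* f :* g)) refl _ _ _ _ _ ⟩
    B * φ (suc e) * φ (suc t) - x * (C * φ (suc e) * φ (suc t))
      ≈⟨ +-cong (*-congˡ (φ-suc t)) (-‿cong (*-congˡ (*-congʳ (*-congˡ (φ-suc e))))) ⟩
    B * φ (suc e) * (φ t * (1# - z)) - x * (C * (φ e * (1# - y)) * φ (suc t))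
      ≈⟨ solve 9 (λ B f g z x C h y k → B :* f :* (g :* z) :- x :* (C :* (h :* y) :* k)
           := B :* f :* g :* z :- x :* (C :* h :* k :* y)) refl _ _ _ _ _ _ _ _ _ ⟩
    B * φ (suc e) * φ t * (1# - z) - x * (C * φ e * φ (suc t) * (1# - y))
      ≈⟨ +-cong (*-congʳ eq₁) (-‿cong (*-congˡ (*-congʳ eq₂))) ⟩
    φ s * (1# - z) - x * (φ s * (1# - y))
      ≈⟨ +-congʳ (*-congˡ (+-congˡ (-‿cong (sym (q^-*₂ (suc (2 ℕ.* k)) (suc e) ≡.refl))))) ⟩
    φ s * (1# - x * y) - x * (φ s * (1# - y))
      ≈⟨ solve 3 (λ F x y → F :* (con (+ 1) :- x :* y) :- x :* (F :* (con (+ 1) :- y)) := F :* (con (+ 1) :- x)) refl _ _ _ ⟩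
    φ s * (1# - x) ∎
    where
    s t : ℕ
    s = 2 ℕ.* (k ℕ.+ suc e)
    t = 2 ℕ.* k ℕ.+ suc e
    B = binom s (suc e)
    C = binom s e
    x = q^ (suc (2 ℕ.* k))
    y = q^ (suc e)
    z = q^ (suc t)
    eq₁ : B * φ (suc e) * φ t ≈ φ s
    eq₁ = ≡.subst (λ n → binom n (suc e) * φ (suc e) * φ t ≈ φ n) index (binom-φ (suc e) t)
      where
      index : suc e ℕ.+ (2 ℕ.* k ℕ.+ suc e) ≡ 2 ℕ.* (k ℕ.+ suc e)
      index = ℕ-solve (k ∷ e ∷ [])
    eq₂ : C * φ e * φ (suc t) ≈ φ s
    eq₂ = ≡.subst (λ n → binom n e * φ e * φ (suc t) ≈ φ n) index (binom-φ e (suc t))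
      where
      index : e ℕ.+ suc (2 ℕ.* k ℕ.+ suc e) ≡ 2 ℕ.* (k ℕ.+ suc e)
      index = ℕ-solve (k ∷ e ∷ [])

  -- The coefficients of the unit Bailey pair relative to q; their usual factor 1 - q^{2k+1} is part
  -- of `D`.
  sgTri : ℕ → Carrier
  sgTri k = sg k * q^ (tri k)

  sgTri-suc : ∀ k → sgTri (suc k) ≈ - (sgTri k * q^ k)
  sgTri-suc k = trans (*-congˡ (pow-+ q (tri k) k))
    (solve 3 (λ s x y → (s :* (:- con (+ 1))) :* (x :* y) := :- (s :* x :* y)) refl _ _ _)

  -- The two Pascal rules, one for each binomial of D, produce the same multiple of [s, e], which
  -- cancels and leaves [s, e+1] - q^{2k+1} [s, e-1]. Inserting q^k [s, e] with both signs gives two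
  -- halves of the same shape, for k and for k + 1.
  D-telescopes : ∀ k e → let s = suc (2 ℕ.* (k ℕ.+ e)) in
    D k (suc e) ≈ (binom s (suc e) - q^ k * binom s e) + q^ k * (binom s e - q^ (suc k) * binomPred s e)
  D-telescopes k e = begin
    D k (suc e)
      ≡⟨ ≡.cong (λ n → binom n (suc e) - x * binom n e) double-suc ⟩
    binom (suc s) (suc e) - x * binom (suc s) e
      ≈⟨ +-cong (binom-pascal s e) (-‿cong (*-congˡ (pascal e))) ⟩
    q^ (s ∸ e) * B + A - x * (C + q^ e * B)
      ≈⟨ +-congʳ (+-congʳ (*-congʳ q^-s∸e)) ⟩
    x * q^ e * B + A - x * (C + q^ e * B)
      ≈⟨ solve 5 (λ x y B A C → x :* y :* B :+ A :- x :* (C :+ y :* B) := A :- x :* C) refl _ _ _ _ _ ⟩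
    A - x * C
      ≈⟨ +-congˡ (-‿cong (*-congʳ (sym (q^-*₂ k (suc k) {suc (2 ℕ.* k)} (ℕ-solve (k ∷ [])))))) ⟩
    A - q^ k * q^ (suc k) * C
      ≈⟨ solve 5 (λ A u v B C → A :- u :* v :* C := (A :- u :* B) :+ u :* (B :- v :* C)) refl _ _ _ _ _ ⟩
    (A - q^ k * B) + q^ k * (B - q^ (suc k) * C) ∎
    where
    s = suc (2 ℕ.* (k ℕ.+ e))
    x = q^ (suc (2 ℕ.* k))
    A = binom s (suc e)
    B = binom s e
    C = binomPred s e
    double-suc : 2 ℕ.* (k ℕ.+ suc e) ≡ suc (suc (2 ℕ.* (k ℕ.+ e)))
    double-suc = ℕ-solve (k ∷ e ∷ [])
    pascal : ∀ e → binom (suc s) e ≈ binomPred s e + q^ e * binom s e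
    pascal zero    = solve 0 (con (+ 1) := con (+ 0) :+ con (+ 1) :* con (+ 1)) refl
    pascal (suc e) = refl
    q^-s∸e : q^ (s ∸ e) ≈ x * q^ e
    q^-s∸e = sym (q^-*₂ (suc (2 ℕ.* k)) e (≡.sym (≡.trans (≡.cong (_∸ e) rearrange) (ℕₚ.m+n∸n≡m (suc (2 ℕ.* k) ℕ.+ e) e))))
      where
      rearrange : suc (2 ℕ.* (k ℕ.+ e)) ≡ suc (2 ℕ.* k) ℕ.+ e ℕ.+ e
      rearrange = ℕ-solve (k ∷ e ∷ [])

  -- Since k + d is constant, all columns use the same row s. As `sgTri (suc k)` is -q^k `sgTri k`,
  -- the second half of the k-th term from `D-telescopes` cancels the first half of the next, and
  -- only the first half at k = 0 survives.
  sum-sgTri-D : ∀ m → let s = suc (2 ℕ.* m) in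
    sum (suc (suc m)) (λ k → sgTri k * D k (suc m ∸ k)) ≈ binom s (suc m) - binom s m
  sum-sgTri-D m = begin
    -- The last term has d = 0, which `D-telescopes` does not reach; its value 1 already has the
    -- form of a first half, so it starts the collapse.
    sum (suc m) f + sgTri (suc m) * D (suc m) (m ∸ m)   ≈⟨ +-cong refl (*-congˡ last) ⟩
    sum (suc m) f + sgTri (suc m) * (1# - q^ (suc m) * 0#) ≈⟨ partial (suc m) 0 (ℕₚ.+-identityʳ (suc m)) ⟩
    1# * 1# * (binom s (suc m) - 1# * binom s m)        ≈⟨ solve 2 (λ x y → con (+ 1) :* con (+ 1) :* (x :- con (+ 1) :* y) := x :- y) refl _ _ ⟩
    binom s (suc m) - binom s m ∎
    where
    s = suc (2 ℕ.* m)
    f : ℕ → Carrier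
    f k = sgTri k * D k (suc m ∸ k)
    tail : ℕ → ℕ → Carrier
    tail k d = sgTri k * (binom s d - q^ k * binomPred s d)
    last : D (suc m) (m ∸ m) ≈ 1# - q^ (suc m) * 0#
    last = trans (reflexive (≡.cong (D (suc m)) (ℕₚ.n∸n≡0 m)))
      (trans (D-zero (suc m)) (solve 1 (λ x → con (+ 1) := con (+ 1) :- x :* con (+ 0)) refl _))
    partial : ∀ k d → k ℕ.+ d ≡ suc m → sum k f + tail k d ≈ tail 0 (suc m)
    partial zero    d ≡.refl = +-identityˡ _
    partial (suc k) d k+d≡m = begin
      sum k f + f k + tail (suc k) d            ≈⟨ +-assoc _ _ _ ⟩
      sum k f + (f k + tail (suc k) d)          ≈⟨ +-congˡ step ⟩
      sum k f + tail k (suc d)                  ≈⟨ partial k (suc d) (≡.trans (ℕₚ.+-suc k d) k+d≡m) ⟩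
      tail 0 (suc m)                            ∎
      where
      k+d≡m′ : k ℕ.+ d ≡ m
      k+d≡m′ = ℕₚ.suc-injective k+d≡m
      index : suc m ∸ k ≡ suc d
      index = ≡.trans (≡.cong (_∸ k) (≡.trans (≡.sym k+d≡m) (≡.sym (ℕₚ.+-suc k d)))) (ℕₚ.m+n∸m≡n k (suc d))
      step : f k + tail (suc k) d ≈ tail k (suc d)
      step = begin
        f k + tail (suc k) d
          ≈⟨ +-cong (*-congˡ (trans (reflexive (≡.cong (D k) index)) (D-telescopes k d))) (*-congʳ (sgTri-suc k)) ⟩
        sgTri k * ((binom s′ (suc d) - q^ k * binom s′ d) + q^ k * (binom s′ d - q^ (suc k) * binomPred s′ d))
          + - (sgTri k * q^ k) * (binom s d - q^ (suc k) * binomPred s d)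
          ≡⟨ ≡.cong (λ n → sgTri k * ((binom (suc (2 ℕ.* n)) (suc d) - q^ k * binom (suc (2 ℕ.* n)) d) + q^ k * (binom (suc (2 ℕ.* n)) d - q^ (suc k) * binomPred (suc (2 ℕ.* n)) d))
          + - (sgTri k * q^ k) * (binom s d - q^ (suc k) * binomPred s d)) k+d≡m′ ⟩
        sgTri k * ((binom s (suc d) - q^ k * binom s d) + q^ k * (binom s d - q^ (suc k) * binomPred s d))
          + - (sgTri k * q^ k) * (binom s d - q^ (suc k) * binomPred s d)
          ≈⟨ solve 4 (λ u X y Z → u :* (X :+ y :* Z) :+ (:- (u :* y)) :* Z := u :* X) refl _ _ _ _ ⟩
        tail k (suc d) ∎
        where s′ = suc (2 ℕ.* (k ℕ.+ d))

  -- With n = m + e, ρ m e = (q)_{2n} / ((q)_{2m} (q)_{n-m}) as a polynomial: it replaces the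
  -- quotient of [n, m] (q^{n+1})_n by (q^{m+1})_m, which need not exist in R.
  ρ : ℕ → ℕ → Carrier
  ρ m e = binom (2 ℕ.* (m ℕ.+ e)) (2 ℕ.* m) * P (suc e) e

  ρ-φ : ∀ m e → ρ m e * φ (2 ℕ.* m) * φ e ≈ φ (2 ℕ.* (m ℕ.+ e))
  ρ-φ m e = begin
    B * P (suc e) e * φ (2 ℕ.* m) * φ e       ≈⟨ solve 4 (λ B p f g → B :* p :* f :* g := B :* f :* (g :* p)) refl _ _ _ _ ⟩
    B * φ (2 ℕ.* m) * (φ e * P (suc e) e)     ≈⟨ *-congˡ (φ-double e) ⟨
    B * φ (2 ℕ.* m) * φ (2 ℕ.* e)             ≈⟨ ≡.subst (λ n → binom n (2 ℕ.* m) * φ (2 ℕ.* m) * φ (2 ℕ.* e) ≈ φ n) (≡.sym (ℕₚ.*-distribˡ-+ 2 m e)) (binom-φ (2 ℕ.* m) (2 ℕ.* e)) ⟩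
    φ (2 ℕ.* (m ℕ.+ e))                       ∎
    where B = binom (2 ℕ.* (m ℕ.+ e)) (2 ℕ.* m)

  ρ-zero : ∀ m → ρ m 0 ≈ 1#
  ρ-zero m = trans (*-identityʳ _)
    (trans (reflexive (≡.cong (λ n → binom (2 ℕ.* n) (2 ℕ.* m)) (ℕₚ.+-identityʳ m))) (binom-self (2 ℕ.* m)))

-- The Bailey chain in the range 2n < N.

module BaileyChain {c ℓ : Level} (R : CommutativeRing c ℓ)
  (domain : IsIntegralDomain R) (charZero : CharZero R)
  (N : ℕ) (q : CommutativeRing.Carrier R) (primRoot : IsPrimitiveRoot R N q) where
  open CommutativeRing R hiding (zero)
  open RingSolver R
  open Sums R
  open QSeries R q
  open BaileyPairs R q
  open Algebra.Properties.Ring ring using (x∙y⁻¹≈ε⇒x≈y)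
  open Relation.Binary.Reasoning.Setoid setoid

  -- `IsIntegralDomain` alone admits the zero ring; characteristic zero excludes it.
  1≉0 : ¬ (1# ≈ 0#)
  1≉0 1≈0 with charZero 1 (trans (+-identityʳ _) 1≈0)
  ... | ()

  *-nonzero : ∀ {x y} → ¬ (x ≈ 0#) → ¬ (y ≈ 0#) → ¬ (x * y ≈ 0#)
  *-nonzero x≉0 y≉0 xy≈0 with domain _ _ xy≈0
  ... | inj₁ x≈0 = x≉0 x≈0
  ... | inj₂ y≈0 = y≉0 y≈0

  zero-cancel : ∀ {x y} → ¬ (x ≈ 0#) → x * y ≈ 0# → y ≈ 0#
  zero-cancel x≉0 xy≈0 with domain _ _ xy≈0
  ... | inj₁ x≈0 = ⊥-elim (x≉0 x≈0)
  ... | inj₂ y≈0 = y≈0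

  *-cancelʳ : ∀ {x a b} → ¬ (x ≈ 0#) → a * x ≈ b * x → a ≈ b
  *-cancelʳ {x} {a} {b} x≉0 ax≈bx = x∙y⁻¹≈ε⇒x≈y a b (zero-cancel x≉0 (begin
    x * (a - b)      ≈⟨ solve 3 (λ x a b → x :* (a :- b) := a :* x :- b :* x) refl _ _ _ ⟩
    a * x - b * x    ≈⟨ +-congʳ ax≈bx ⟩
    b * x - b * x    ≈⟨ -‿inverseʳ _ ⟩
    0#               ∎))

  1-q^-nonzero : ∀ k → 0 < k → k < N → ¬ (1# - q^ k ≈ 0#)
  1-q^-nonzero k 0<k k<N eq = proj₂ primRoot k 0<k k<N (sym (x∙y⁻¹≈ε⇒x≈y _ _ eq))

  -- Primitivity keeps every factor 1 - q^k with 0 < k < N away from zero. This is what allows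
  -- cancellation, and it confines the chain to 2n < N, where factors up to (q)_{2n} have to be
  -- cancelled.
  φ-nonzero : ∀ n → n < N → ¬ (φ n ≈ 0#)
  φ-nonzero zero    _   eq = 1≉0 eq
  φ-nonzero (suc n) n<N eq =
    *-nonzero (φ-nonzero n (ℕₚ.<⇒≤ n<N)) (1-q^-nonzero (suc n) z<s n<N) (trans (sym (φ-suc n)) eq)

  m≤2*m : ∀ m → m ≤ 2 ℕ.* m
  m≤2*m m = ℕₚ.m≤m+n m _

  -- At the centre of an odd row, absorption has the factor 1 - q^{m+1} on both sides. The equality
  -- annihilates the value found in `sum-sgTri-D`, as the unit pair demands.
  binom-middle : ∀ m → suc m < N → binom (suc (2 ℕ.* m)) (suc m) ≈ binom (suc (2 ℕ.* m)) m
  binom-middle m m<N = *-cancelʳ (1-q^-nonzero (suc m) z<s m<N)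
    (trans (binom-absorb (suc (2 ℕ.* m)) m) (*-congˡ (+-congˡ (-‿cong (q^-≡ index)))))
    where
    index : suc (2 ℕ.* m) ∸ m ≡ suc m
    index = ≡.trans (≡.cong (λ n → suc (m ℕ.+ n) ∸ m) (ℕₚ.+-identityʳ m)) (ℕₚ.m+n∸n≡m (suc m) m)

  -- Times (q)_m (q)_e, both sides are (q)_{2(m+e)}. The lemma makes `P (suc m) m` appear beside the
  -- m-th term of a chain step, so that the hypothesis on that term applies.
  ρ-binom : ∀ m e → 2 ℕ.* (m ℕ.+ e) < N →
    P (suc (m ℕ.+ e)) (m ℕ.+ e) * binom (m ℕ.+ e) m ≈ ρ m e * P (suc m) m
  ρ-binom m e 2n<N = *-cancelʳ (*-nonzero (φ-nonzero m (below (ℕₚ.m≤m+n m e))) (φ-nonzero e (below (ℕₚ.m≤n+m e m)))) (begin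
    P (suc n) n * binom n m * (φ m * φ e)        ≈⟨ solve 4 (λ p b f g → p :* b :* (f :* g) := b :* f :* g :* p) refl _ _ _ _ ⟩
    binom n m * φ m * φ e * P (suc n) n          ≈⟨ *-congʳ (binom-φ m e) ⟩
    φ n * P (suc n) n                            ≈⟨ φ-double n ⟨
    φ (2 ℕ.* n)                                  ≈⟨ ρ-φ m e ⟨
    ρ m e * φ (2 ℕ.* m) * φ e                    ≈⟨ *-congʳ (*-congˡ (φ-double m)) ⟩
    ρ m e * (φ m * P (suc m) m) * φ e            ≈⟨ solve 4 (λ r f p g → r :* (f :* p) :* g := r :* p :* (f :* g)) refl _ _ _ _ ⟩
    ρ m e * P (suc m) m * (φ m * φ e)            ∎)
    where
    n = m ℕ.+ e
    below : ∀ {i} → i ≤ n → i < N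
    below i≤n = ℕₚ.≤-<-trans (ℕₚ.≤-trans i≤n (m≤2*m n)) 2n<N

  -- After multiplication by (q)_{2(k+j)}, `ρ-φ` and `D-φ` evaluate the left side. The last factor
  -- on the right is the j-th summand of `vandermonde` for c = 2k + 1, up to its power of q.
  ρ-D : ∀ k j e → 2 ℕ.* (k ℕ.+ (j ℕ.+ e)) < N →
    ρ (k ℕ.+ j) e * D k j * (φ (j ℕ.+ e) * φ (suc (2 ℕ.* k ℕ.+ (j ℕ.+ e)))) ≈
    φ (2 ℕ.* (k ℕ.+ (j ℕ.+ e))) * (1# - q^ (suc (2 ℕ.* k))) * (binom (j ℕ.+ e) j * P (suc (suc (2 ℕ.* k) ℕ.+ j)) e)
  ρ-D k j e 2n<N = *-cancelʳ (φ-nonzero (2 ℕ.* m) 2m<N) (begin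
    r * d * (φ (j ℕ.+ e) * φ (suc (2 ℕ.* k ℕ.+ (j ℕ.+ e)))) * φ (2 ℕ.* m)
      ≈⟨ *-congʳ (*-congˡ (*-cong (sym (binom-φ j e)) φ-split)) ⟩
    r * d * (B * φ j * φ e * (φ (suc (2 ℕ.* k ℕ.+ j)) * p)) * φ (2 ℕ.* m)
      ≈⟨ solve 8 (λ r d B f g h p x → r :* d :* (B :* f :* g :* (h :* p)) :* x := r :* x :* g :* (f :* h :* d) :* (B :* p)) refl _ _ _ _ _ _ _ _ ⟩
    r * φ (2 ℕ.* m) * φ e * (φ j * φ (suc (2 ℕ.* k ℕ.+ j)) * d) * (B * p)
      ≈⟨ *-congʳ (*-cong (ρ-φ m e) (D-φ k j)) ⟩
    φ (2 ℕ.* (m ℕ.+ e)) * (φ (2 ℕ.* m) * x) * (B * p)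
      ≈⟨ *-congʳ (*-congʳ (reflexive (≡.cong (λ n → φ (2 ℕ.* n)) (ℕₚ.+-assoc k j e)))) ⟩
    φ (2 ℕ.* (k ℕ.+ (j ℕ.+ e))) * (φ (2 ℕ.* m) * x) * (B * p)
      ≈⟨ solve 4 (λ a b x y → a :* (b :* x) :* y := a :* x :* y :* b) refl _ _ _ _ ⟩
    φ (2 ℕ.* (k ℕ.+ (j ℕ.+ e))) * x * (B * p) * φ (2 ℕ.* m) ∎)
    where
    m = k ℕ.+ j
    r = ρ m e
    d = D k j
    B = binom (j ℕ.+ e) j
    p = P (suc (suc (2 ℕ.* k) ℕ.+ j)) e
    x = 1# - q^ (suc (2 ℕ.* k))
    2m<N : 2 ℕ.* m < N
    2m<N = ℕₚ.≤-<-trans (ℕₚ.*-monoʳ-≤ 2 (ℕₚ.≤-trans (ℕₚ.m≤m+n m e) (ℕₚ.≤-reflexive (ℕₚ.+-assoc k j e)))) 2n<N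
    φ-split : φ (suc (2 ℕ.* k ℕ.+ (j ℕ.+ e))) ≈ φ (suc (2 ℕ.* k ℕ.+ j)) * p
    φ-split = trans (reflexive (≡.cong (λ n → φ (suc n)) (≡.sym (ℕₚ.+-assoc (2 ℕ.* k) j e)))) (P-+ 1 (suc (2 ℕ.* k ℕ.+ j)) e)

  -- The heart of Bailey's lemma: with k fixed, the sum over the intermediate index m = k + j is
  -- `vandermonde` with c = 2k + 1.
  ρ-D-sum : ∀ k L → 2 ℕ.* (k ℕ.+ L) < N →
    sum (suc L) (λ j → q^ ((k ℕ.+ j) ℕ.* (k ℕ.+ j) ℕ.+ (k ℕ.+ j)) * ρ (k ℕ.+ j) (L ∸ j) * D k j) ≈
    q^ (k ℕ.* k ℕ.+ k) * D k L
  -- For L = 0 the factor (q)_{2k+1} of `Φ` may vanish, since 2k + 1 = N is allowed; the single term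
  -- is computed directly.
  ρ-D-sum k zero _ = begin
    0# + q^ ((k ℕ.+ 0) ℕ.* (k ℕ.+ 0) ℕ.+ (k ℕ.+ 0)) * ρ (k ℕ.+ 0) 0 * D k 0   ≈⟨ +-identityˡ _ ⟩
    q^ ((k ℕ.+ 0) ℕ.* (k ℕ.+ 0) ℕ.+ (k ℕ.+ 0)) * ρ (k ℕ.+ 0) 0 * D k 0
      ≈⟨ *-congʳ (trans (*-congˡ (ρ-zero (k ℕ.+ 0))) (*-identityʳ _)) ⟩
    q^ ((k ℕ.+ 0) ℕ.* (k ℕ.+ 0) ℕ.+ (k ℕ.+ 0)) * D k 0
      ≡⟨ ≡.cong (λ m → q^ (m ℕ.* m ℕ.+ m) * D k 0) (ℕₚ.+-identityʳ k) ⟩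
    q^ (k ℕ.* k ℕ.+ k) * D k 0  ∎
  ρ-D-sum k L@(suc L′) 2n<N = *-cancelʳ Φ≉0 (begin
    sum (suc L) (λ j → q^ ((k ℕ.+ j) ℕ.* (k ℕ.+ j) ℕ.+ (k ℕ.+ j)) * ρ (k ℕ.+ j) (L ∸ j) * D k j) * Φ
      ≈⟨ trans (*-comm _ _) (*-sum (suc L) Φ _) ⟩
    sum (suc L) (λ j → Φ * (q^ ((k ℕ.+ j) ℕ.* (k ℕ.+ j) ℕ.+ (k ℕ.+ j)) * ρ (k ℕ.+ j) (L ∸ j) * D k j))
      ≈⟨ sum-cong (suc L) (λ j j<1+L → term j (s≤s⁻¹ j<1+L)) ⟩
    sum (suc L) (λ j → q^ (k ℕ.* k ℕ.+ k) * X * (q^ (j ℕ.* j ℕ.+ b ℕ.* j) * binom L j * P (suc (b ℕ.+ j)) (L ∸ j)))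
      ≈⟨ *-sum (suc L) (q^ (k ℕ.* k ℕ.+ k) * X) _ ⟨
    q^ (k ℕ.* k ℕ.+ k) * X * sum (suc L) (λ j → q^ (j ℕ.* j ℕ.+ b ℕ.* j) * binom L j * P (suc (b ℕ.+ j)) (L ∸ j))
      ≈⟨ trans (*-congˡ (vandermonde L b)) (*-identityʳ _) ⟩
    q^ (k ℕ.* k ℕ.+ k) * X
      ≈⟨ *-congˡ (D-φ k L) ⟨
    q^ (k ℕ.* k ℕ.+ k) * (Φ * D k L)
      ≈⟨ solve 3 (λ x y z → x :* (y :* z) := x :* z :* y) refl _ _ _ ⟩
    q^ (k ℕ.* k ℕ.+ k) * D k L * Φ ∎)
    where
    b = suc (2 ℕ.* k)
    Φ = φ L * φ (suc (2 ℕ.* k ℕ.+ L))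
    X = φ (2 ℕ.* (k ℕ.+ L)) * (1# - q^ b)
    Φ≉0 : ¬ (Φ ≈ 0#)
    Φ≉0 = *-nonzero (φ-nonzero L (ℕₚ.≤-<-trans (ℕₚ.≤-trans (ℕₚ.m≤n+m L k) (m≤2*m (k ℕ.+ L))) 2n<N))
                    (φ-nonzero _ (ℕₚ.≤-<-trans index 2n<N))
      where
      index : suc (2 ℕ.* k ℕ.+ suc L′) ≤ 2 ℕ.* (k ℕ.+ suc L′)
      index = ≡.subst (suc (2 ℕ.* k ℕ.+ suc L′) ≤_) eq (ℕₚ.m≤m+n _ L′)
        where
        eq : suc (2 ℕ.* k ℕ.+ suc L′) ℕ.+ L′ ≡ 2 ℕ.* (k ℕ.+ suc L′)
        eq = ℕ-solve (k ∷ L′ ∷ [])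
    term : ∀ j → j ≤ L →
      Φ * (q^ ((k ℕ.+ j) ℕ.* (k ℕ.+ j) ℕ.+ (k ℕ.+ j)) * ρ (k ℕ.+ j) (L ∸ j) * D k j) ≈
      q^ (k ℕ.* k ℕ.+ k) * X * (q^ (j ℕ.* j ℕ.+ b ℕ.* j) * binom L j * P (suc (b ℕ.+ j)) (L ∸ j))
    term j j≤L = begin
      Φ * (q^ ((k ℕ.+ j) ℕ.* (k ℕ.+ j) ℕ.+ (k ℕ.+ j)) * ρ (k ℕ.+ j) (L ∸ j) * D k j)
        ≈⟨ solve 4 (λ F x r d → F :* (x :* r :* d) := x :* (r :* d :* F)) refl _ _ _ _ ⟩
      q^ ((k ℕ.+ j) ℕ.* (k ℕ.+ j) ℕ.+ (k ℕ.+ j)) * (ρ (k ℕ.+ j) (L ∸ j) * D k j * Φ)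
        ≈⟨ *-cong q^-split ρD ⟩
      q^ (k ℕ.* k ℕ.+ k) * q^ (j ℕ.* j ℕ.+ b ℕ.* j) * (X * (binom L j * P (suc (b ℕ.+ j)) (L ∸ j)))
        ≈⟨ solve 5 (λ x y X b p → x :* y :* (X :* (b :* p)) := x :* X :* (y :* b :* p)) refl _ _ _ _ _ ⟩
      q^ (k ℕ.* k ℕ.+ k) * X * (q^ (j ℕ.* j ℕ.+ b ℕ.* j) * binom L j * P (suc (b ℕ.+ j)) (L ∸ j)) ∎
      where
      q^-split : q^ ((k ℕ.+ j) ℕ.* (k ℕ.+ j) ℕ.+ (k ℕ.+ j)) ≈ q^ (k ℕ.* k ℕ.+ k) * q^ (j ℕ.* j ℕ.+ b ℕ.* j)
      q^-split = sym (q^-*₂ (k ℕ.* k ℕ.+ k) (j ℕ.* j ℕ.+ b ℕ.* j) index)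
        where
        index : k ℕ.* k ℕ.+ k ℕ.+ (j ℕ.* j ℕ.+ suc (2 ℕ.* k) ℕ.* j) ≡ (k ℕ.+ j) ℕ.* (k ℕ.+ j) ℕ.+ (k ℕ.+ j)
        index = ℕ-solve (k ∷ j ∷ [])
      ρD : ρ (k ℕ.+ j) (L ∸ j) * D k j * Φ ≈ X * (binom L j * P (suc (b ℕ.+ j)) (L ∸ j))
      ρD = ≡.subst (λ l → 2 ℕ.* (k ℕ.+ l) < N →
          ρ (k ℕ.+ j) (L ∸ j) * D k j * (φ l * φ (suc (2 ℕ.* k ℕ.+ l))) ≈
          φ (2 ℕ.* (k ℕ.+ l)) * (1# - q^ b) * (binom l j * P (suc (b ℕ.+ j)) (L ∸ j)))
        (ℕₚ.m+[n∸m]≡n j≤L) (ρ-D k j (L ∸ j)) 2n<N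

  -- Bailey's lemma relative to q with both parameters sent to infinity, where x m stands for (q)_m
  -- β_m. Exchanging the sums isolates, for each `a k`, the inner sum evaluated by `ρ-D-sum`.
  bailey-step : ∀ (a x : ℕ → Carrier) →
    (∀ m → 2 ℕ.* m < N → P (suc m) m * x m ≈ sum (suc m) (λ k → a k * D k (m ∸ k))) →
    ∀ n → 2 ℕ.* n < N →
    P (suc n) n * sum (suc n) (λ m → q^ (m ℕ.* m ℕ.+ m) * binom n m * x m) ≈
    sum (suc n) (λ k → a k * q^ (k ℕ.* k ℕ.+ k) * D k (n ∸ k))
  bailey-step a x pair n 2n<N = begin
    P (suc n) n * sum (suc n) (λ m → q^ (m ℕ.* m ℕ.+ m) * binom n m * x m)
      ≈⟨ *-sum (suc n) _ _ ⟩
    sum (suc n) (λ m → P (suc n) n * (q^ (m ℕ.* m ℕ.+ m) * binom n m * x m))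
      ≈⟨ sum-cong (suc n) (λ m m<1+n → expand m (s≤s⁻¹ m<1+n)) ⟩
    sum (suc n) (λ m → sum (suc m) (λ k → F k (m ∸ k)))
      ≈⟨ sum-triangle (suc n) F ⟩
    sum (suc n) (λ k → sum (suc n ∸ k) (F k))
      ≈⟨ sum-cong (suc n) (λ k k<1+n → collapse k (s≤s⁻¹ k<1+n)) ⟩
    sum (suc n) (λ k → a k * q^ (k ℕ.* k ℕ.+ k) * D k (n ∸ k)) ∎
    where
    weight : ℕ → Carrier
    weight m = q^ (m ℕ.* m ℕ.+ m) * ρ m (n ∸ m)

    F : ℕ → ℕ → Carrier
    F k d = a k * (weight (k ℕ.+ d) * D k d)

    expand : ∀ m → m ≤ n → P (suc n) n * (q^ (m ℕ.* m ℕ.+ m) * binom n m * x m) ≈ sum (suc m) (λ k → F k (m ∸ k))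
    expand m m≤n = begin
      P (suc n) n * (q^ (m ℕ.* m ℕ.+ m) * binom n m * x m)
        ≈⟨ solve 4 (λ p y b x → p :* (y :* b :* x) := y :* (p :* b) :* x) refl _ _ _ _ ⟩
      q^ (m ℕ.* m ℕ.+ m) * (P (suc n) n * binom n m) * x m
        ≈⟨ *-congʳ (*-congˡ (≡.subst (λ l → 2 ℕ.* l < N → P (suc l) l * binom l m ≈ ρ m (n ∸ m) * P (suc m) m)
             (ℕₚ.m+[n∸m]≡n m≤n) (ρ-binom m (n ∸ m)) 2n<N)) ⟩
      q^ (m ℕ.* m ℕ.+ m) * (ρ m (n ∸ m) * P (suc m) m) * x m
        ≈⟨ solve 4 (λ y r p x → y :* (r :* p) :* x := y :* r :* (p :* x)) refl _ _ _ _ ⟩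
      weight m * (P (suc m) m * x m)
        ≈⟨ *-congˡ (pair m (ℕₚ.≤-<-trans (ℕₚ.*-monoʳ-≤ 2 m≤n) 2n<N)) ⟩
      weight m * sum (suc m) (λ k → a k * D k (m ∸ k))
        ≈⟨ *-sum (suc m) _ _ ⟩
      sum (suc m) (λ k → weight m * (a k * D k (m ∸ k)))
        ≈⟨ sum-cong (suc m) (λ k k<1+m → trans
             (solve 3 (λ w a d → w :* (a :* d) := a :* (w :* d)) refl _ _ _)
             (reflexive (≡.cong (λ l → a k * (weight l * D k (m ∸ k))) (≡.sym (ℕₚ.m+[n∸m]≡n (s≤s⁻¹ k<1+m)))))) ⟩
      sum (suc m) (λ k → F k (m ∸ k)) ∎

    collapse : ∀ k → k ≤ n → sum (suc n ∸ k) (F k) ≈ a k * q^ (k ℕ.* k ℕ.+ k) * D k (n ∸ k)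
    collapse k k≤n = begin
      sum (suc n ∸ k) (F k)
        ≡⟨ ≡.cong (λ l → sum l (F k)) (ℕₚ.+-∸-assoc 1 k≤n) ⟩
      sum (suc (n ∸ k)) (F k)
        ≈⟨ *-sum (suc (n ∸ k)) (a k) _ ⟨
      a k * sum (suc (n ∸ k)) (λ d → weight (k ℕ.+ d) * D k d)
        ≈⟨ *-congˡ (sum-cong (suc (n ∸ k)) (λ d _ → reflexive
             (≡.cong (λ l → q^ ((k ℕ.+ d) ℕ.* (k ℕ.+ d) ℕ.+ (k ℕ.+ d)) * ρ (k ℕ.+ d) l * D k d) (≡.sym (ℕₚ.∸-+-assoc n k d))))) ⟩
      a k * sum (suc (n ∸ k)) (λ d → q^ ((k ℕ.+ d) ℕ.* (k ℕ.+ d) ℕ.+ (k ℕ.+ d)) * ρ (k ℕ.+ d) (n ∸ k ∸ d) * D k d)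
        ≈⟨ *-congˡ (ρ-D-sum k (n ∸ k) (≡.subst (λ l → 2 ℕ.* l < N) (≡.sym (ℕₚ.m+[n∸m]≡n k≤n)) 2n<N)) ⟩
      a k * (q^ (k ℕ.* k ℕ.+ k) * D k (n ∸ k))
        ≈⟨ *-assoc _ _ _ ⟨
      a k * q^ (k ℕ.* k ℕ.+ k) * D k (n ∸ k) ∎

  chainWeight : ℕ → ℕ → Carrier
  chainWeight i k = sg k * q^ (tri k ℕ.+ i ℕ.* (k ℕ.* k ℕ.+ k))

  δ : ℕ → Carrier
  δ zero    = 1#
  δ (suc _) = 0#

  unit-pair : ∀ n → 2 ℕ.* n < N → P (suc n) n * δ n ≈ sum (suc n) (λ k → sgTri k * D k (n ∸ k))
  unit-pair zero _ = sym (trans (+-identityˡ _) (*-cong (*-identityˡ _) (D-zero 0)))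
  unit-pair (suc m) 2n<N = begin
    P (suc (suc m)) (suc m) * 0#                          ≈⟨ zeroʳ _ ⟩
    0#                                                    ≈⟨ -‿inverseʳ _ ⟨
    binom s m - binom s m                                 ≈⟨ +-congʳ (binom-middle m (ℕₚ.≤-<-trans (m≤2*m (suc m)) 2n<N)) ⟨
    binom s (suc m) - binom s m                           ≈⟨ sum-sgTri-D m ⟨
    sum (suc (suc m)) (λ k → sgTri k * D k (suc m ∸ k))   ∎
    where s = suc (2 ℕ.* m)

  -- `inner` at i is reached after i + 1 steps: the first turns δ into the constant 1, because only
  -- m = 0 contributes. Each step multiplies the weight by q^{k^2+k}.
  inner-pair : ∀ i n → 2 ℕ.* n < N →
    P (suc n) n * inner R q i n ≈ sum (suc n) (λ k → chainWeight (suc i) k * D k (n ∸ k))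
  inner-pair zero n 2n<N = begin
    P (suc n) n * 1#
      ≈⟨ *-congˡ unit-sum ⟨
    P (suc n) n * sum (suc n) (λ m → q^ (m ℕ.* m ℕ.+ m) * binom n m * δ m)
      ≈⟨ bailey-step sgTri δ unit-pair n 2n<N ⟩
    sum (suc n) (λ k → sgTri k * q^ (k ℕ.* k ℕ.+ k) * D k (n ∸ k))
      ≈⟨ sum-cong (suc n) (λ k _ → *-congʳ (trans (*-assoc _ _ _)
           (*-congˡ (q^-*₂ (tri k) (k ℕ.* k ℕ.+ k) (≡.cong (tri k ℕ.+_) (≡.sym (ℕₚ.+-identityʳ _))))))) ⟩
    sum (suc n) (λ k → chainWeight 1 k * D k (n ∸ k)) ∎
    where
    unit-sum : sum (suc n) (λ m → q^ (m ℕ.* m ℕ.+ m) * binom n m * δ m) ≈ 1#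
    unit-sum = begin
      sum (suc n) (λ m → q^ (m ℕ.* m ℕ.+ m) * binom n m * δ m)
        ≈⟨ sum-head n _ ⟩
      1# * 1# * 1# + sum n (λ m → q^ (suc m ℕ.* suc m ℕ.+ suc m) * binom n (suc m) * 0#)
        ≈⟨ +-cong (trans (*-identityʳ _) (*-identityʳ _)) (sum-zero n (λ m _ → zeroʳ _)) ⟩
      1# + 0#
        ≈⟨ +-identityʳ _ ⟩
      1# ∎
  inner-pair (suc i) n 2n<N = begin
    P (suc n) n * sum (suc n) (λ m → q^ (m ℕ.* m ℕ.+ m) * binom n m * inner R q i m)
      ≈⟨ bailey-step (chainWeight (suc i)) (inner R q i) (inner-pair i) n 2n<N ⟩
    sum (suc n) (λ k → chainWeight (suc i) k * q^ (k ℕ.* k ℕ.+ k) * D k (n ∸ k))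
      ≈⟨ sum-cong (suc n) (λ k _ → *-congʳ (trans (*-assoc _ _ _) (*-congˡ (merge k)))) ⟩
    sum (suc n) (λ k → chainWeight (suc (suc i)) k * D k (n ∸ k)) ∎
    where
    merge : ∀ k → q^ (tri k ℕ.+ suc i ℕ.* (k ℕ.* k ℕ.+ k)) * q^ (k ℕ.* k ℕ.+ k) ≈ q^ (tri k ℕ.+ suc (suc i) ℕ.* (k ℕ.* k ℕ.+ k))
    merge k = q^-*₂ (tri k ℕ.+ suc i ℕ.* (k ℕ.* k ℕ.+ k)) (k ℕ.* k ℕ.+ k)
      (≡.trans (ℕₚ.+-assoc (tri k) _ _) (≡.cong (tri k ℕ.+_) (ℕₚ.+-comm (suc i ℕ.* (k ℕ.* k ℕ.+ k)) _)))

-- The pentagonal numbers s(3s-1)/2; the companion family s(3s+1)/2 is `pent s` + s. The increment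
-- 3s + 1 is the exponent in the recurrence of `A` at index 3s.
pent : ℕ → ℕ
pent zero    = 0
pent (suc s) = pent s ℕ.+ suc (s ℕ.* 3)

pent-double : ∀ s → 2 ℕ.* pent s ℕ.+ s ≡ 3 ℕ.* (s ℕ.* s)
pent-double zero    = ≡.refl
pent-double (suc s) = begin
  2 ℕ.* (pent s ℕ.+ suc (s ℕ.* 3)) ℕ.+ suc s         ≡⟨ regroup (pent s) ⟩
  (2 ℕ.* pent s ℕ.+ s) ℕ.+ (3 ℕ.+ 6 ℕ.* s)           ≡⟨ ≡.cong (ℕ._+ (3 ℕ.+ 6 ℕ.* s)) (pent-double s) ⟩
  3 ℕ.* (s ℕ.* s) ℕ.+ (3 ℕ.+ 6 ℕ.* s)                ≡⟨ ℕ-solve (s ∷ []) ⟩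
  3 ℕ.* (suc s ℕ.* suc s)                            ∎
  where
  open ≡.≡-Reasoning
  regroup : ∀ p → 2 ℕ.* (p ℕ.+ suc (s ℕ.* 3)) ℕ.+ suc s ≡ (2 ℕ.* p ℕ.+ s) ℕ.+ (3 ℕ.+ 6 ℕ.* s)
  regroup p = ℕ-solve (p ∷ s ∷ [])

pent-even : ∀ r → pent (2 ℕ.* r) ℕ.+ r ≡ 6 ℕ.* r ℕ.* r
pent-even r = ℕₚ.*-cancelˡ-≡ _ _ 2 (begin
  2 ℕ.* (pent (2 ℕ.* r) ℕ.+ r)              ≡⟨ ℕₚ.*-distribˡ-+ 2 (pent (2 ℕ.* r)) r ⟩
  2 ℕ.* pent (2 ℕ.* r) ℕ.+ 2 ℕ.* r          ≡⟨ pent-double (2 ℕ.* r) ⟩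
  3 ℕ.* ((2 ℕ.* r) ℕ.* (2 ℕ.* r))           ≡⟨ ℕ-solve (r ∷ []) ⟩
  2 ℕ.* (6 ℕ.* r ℕ.* r)                     ∎)
  where open ≡.≡-Reasoning

pent-odd : ∀ s → pent (suc (2 ℕ.* s)) ≡ suc (2 ℕ.* s) ℕ.* suc (s ℕ.* 3)
pent-odd s = ≡.trans (regroup (pent (2 ℕ.* s))) (≡.trans (≡.cong (λ x → x ℕ.+ 5 ℕ.* s ℕ.+ 1) (pent-even s)) index)
  where
  regroup : ∀ p → p ℕ.+ suc (2 ℕ.* s ℕ.* 3) ≡ p ℕ.+ s ℕ.+ 5 ℕ.* s ℕ.+ 1
  regroup p = ℕ-solve (p ∷ s ∷ [])
  index : 6 ℕ.* s ℕ.* s ℕ.+ 5 ℕ.* s ℕ.+ 1 ≡ suc (2 ℕ.* s) ℕ.* suc (s ℕ.* 3)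
  index = ℕ-solve (s ∷ [])

-- Cigler's sums, pentagonal powers and the coefficients α.

module CiglerSums {c ℓ : Level} (R : CommutativeRing c ℓ) (q : CommutativeRing.Carrier R) where
  open CommutativeRing R hiding (zero)
  open RingSolver R
  open Sums R
  open QSeries R q
  open Relation.Binary.Reasoning.Setoid setoid

  -- Up to a repeated initial 1, the nonzero values are the successive terms of Euler's pentagonal
  -- series 1 - q - q^2 + q^5 + q^7 - ...; indices congruent to 2 modulo 3 give 0.
  A : ℕ → Carrier
  A 0 = 1#
  A 1 = 1#
  A 2 = 0#
  A (suc (suc (suc n))) = - (q^ (suc n) * A n)

  aTerm gTerm : ℕ → ℕ → Carrier
  aTerm n i = sg i * q^ (tri i) * binom (n ∸ i) i
  gTerm n i = sg i * q^ (tri (suc i)) * binom (n ∸ i) i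

  ASum G : ℕ → Carrier
  ASum n = sum (suc n) (aTerm n)
  G n    = sum (suc n) (gTerm n)

  binom-∸-zero : ∀ n i → n < i ℕ.+ i → binom (n ∸ i) i ≈ 0#
  binom-∸-zero n i@(suc _) n<2i = binom-zero (n ∸ i) i (ℕₚ.m<n+o⇒m∸n<o n i n<2i)

  aTerm-zero : ∀ n i → n < i ℕ.+ i → aTerm n i ≈ 0#
  aTerm-zero n i n<2i = trans (*-congˡ (binom-∸-zero n i n<2i)) (zeroʳ _)

  gTerm-zero : ∀ n i → n < i ℕ.+ i → gTerm n i ≈ 0#
  gTerm-zero n i n<2i = trans (*-congˡ (binom-∸-zero n i n<2i)) (zeroʳ _)

  n<m⇒n<m+m : ∀ {n m} → n < m → n < m ℕ.+ m
  n<m⇒n<m+m {_} {m} n<m = ℕₚ.<-≤-trans n<m (ℕₚ.m≤m+n m m)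

  sum-aTerm : ∀ n L → suc n ≤ L → sum L (aTerm n) ≈ ASum n
  sum-aTerm n L n<L = sum-extend (aTerm n) n<L (λ i n<i → aTerm-zero n i (n<m⇒n<m+m n<i))

  -- Terms with 2i > n vanish, so every length L with 2L > n gives the same sum. This serves both
  -- the recurrences, which sum too far, and the columns, which stop near n/2.
  sum-gTerm : ∀ n L → n < L ℕ.+ L → sum L (gTerm n) ≈ G n
  sum-gTerm n L n<2L with suc n ℕ.≤? L
  ... | yes n<L = sum-extend (gTerm n) n<L (λ i n<i → gTerm-zero n i (n<m⇒n<m+m n<i))
  ... | no  n≮L = sym (sum-extend (gTerm n) (ℕₚ.<⇒≤ (ℕₚ.≰⇒> n≮L))
                    (λ i L≤i → gTerm-zero n i (ℕₚ.<-≤-trans n<2L (ℕₚ.+-mono-≤ L≤i L≤i))))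

  sg-suc* : ∀ i x → sg (suc i) * x ≈ - (sg i * x)
  sg-suc* i x = solve 2 (λ s x → s :* (:- con (+ 1)) :* x := :- (s :* x)) refl _ _

  -- The defining Pascal rule applied to [n+1-i, i+1]: the weight q^{i+1} of its second part turns
  -- the exponent i(i+1)/2 into (i+1)(i+2)/2, that of `gTerm`.
  aTerm-suc : ∀ n i → aTerm (suc (suc n)) (suc i) ≈ gTerm (suc n) (suc i) - gTerm n i
  aTerm-suc n i with i ℕ.≤? n
  ... | yes i≤n = begin
    sg (suc i) * q^ (tri (suc i)) * binom (suc n ∸ i) (suc i)
      ≡⟨ ≡.cong (λ m → sg (suc i) * q^ (tri (suc i)) * binom m (suc i)) (ℕₚ.+-∸-assoc 1 i≤n) ⟩
    sg (suc i) * q^ (tri (suc i)) * (binom (n ∸ i) i + q^ (suc i) * binom (n ∸ i) (suc i))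
      ≈⟨ solve 5 (λ s x b y b′ → s :* (:- con (+ 1)) :* x :* (b :+ y :* b′) := s :* (:- con (+ 1)) :* (x :* y) :* b′ :- s :* x :* b) refl _ _ _ _ _ ⟩
    sg (suc i) * (q^ (tri (suc i)) * q^ (suc i)) * binom (n ∸ i) (suc i) - gTerm n i
      ≈⟨ +-congʳ (*-congʳ (*-congˡ (q^-*₂ (tri (suc i)) (suc i) ≡.refl))) ⟩
    gTerm (suc n) (suc i) - gTerm n i ∎
  ... | no i≰n = begin
    aTerm (suc (suc n)) (suc i)            ≈⟨ aTerm-zero (suc (suc n)) (suc i) (≡.subst (suc (suc n) <_) (≡.sym (ℕₚ.+-suc (suc i) i)) (s<s (s<s (n<m⇒n<m+m n<i)))) ⟩
    0#                                     ≈⟨ -‿inverseʳ 0# ⟨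
    0# - 0#                                ≈⟨ +-cong (gTerm-zero (suc n) (suc i) (n<m⇒n<m+m (s<s n<i))) (-‿cong (gTerm-zero n i (n<m⇒n<m+m n<i))) ⟨
    gTerm (suc n) (suc i) - gTerm n i      ∎
    where n<i = ℕₚ.≰⇒> i≰n

  -- Here the second Pascal rule is the right one: its weight q^{n-2i} combines with
  -- q^{(i+1)(i+2)/2} to q^{n+1} q^{i(i-1)/2}, so that q^{n+1} no longer depends on i and leaves the
  -- sum.
  gTerm-suc : ∀ n i → gTerm (suc (suc n)) (suc i) ≈ gTerm (suc n) (suc i) - q^ (suc n) * aTerm n i
  gTerm-suc n i with i ℕ.≤? n
  ... | yes i≤n = begin
    sg (suc i) * X * binom (suc n ∸ i) (suc i)
      ≡⟨ ≡.cong (λ m → sg (suc i) * X * binom m (suc i)) (ℕₚ.+-∸-assoc 1 i≤n) ⟩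
    sg (suc i) * X * binom (suc (n ∸ i)) (suc i)
      ≈⟨ *-congˡ (binom-pascal (n ∸ i) i) ⟩
    sg (suc i) * X * (q^ (n ∸ i ∸ i) * B + C)
      ≈⟨ solve 5 (λ s x y b c → s :* (:- con (+ 1)) :* x :* (y :* b :+ c) := s :* (:- con (+ 1)) :* x :* c :- s :* (x :* y :* b)) refl _ _ _ _ _ ⟩
    gTerm (suc n) (suc i) - sg i * (X * q^ (n ∸ i ∸ i) * B)
      ≈⟨ +-congˡ (-‿cong (*-congˡ exponents)) ⟩
    gTerm (suc n) (suc i) - sg i * (q^ (suc n) * q^ (tri i) * B)
      ≈⟨ +-congˡ (-‿cong (solve 4 (λ s x y b → s :* (x :* y :* b) := x :* (s :* y :* b)) refl _ _ _ _)) ⟩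
    gTerm (suc n) (suc i) - q^ (suc n) * aTerm n i ∎
    where
    X = q^ (tri (suc (suc i)))
    B = binom (n ∸ i) i
    C = binom (n ∸ i) (suc i)
    exponents : X * q^ (n ∸ i ∸ i) * B ≈ q^ (suc n) * q^ (tri i) * B
    exponents with i ℕ.+ i ℕ.≤? n
    ... | yes 2i≤n = *-congʳ (trans (q^-*₂ (tri (suc (suc i))) (n ∸ i ∸ i) index) (pow-+ q (suc n) (tri i)))
      where
      regroup : ∀ t m → t ℕ.+ i ℕ.+ suc i ℕ.+ m ≡ suc (i ℕ.+ i ℕ.+ m) ℕ.+ t
      regroup t m = ℕ-solve (t ∷ m ∷ i ∷ [])
      index : tri (suc (suc i)) ℕ.+ (n ∸ i ∸ i) ≡ suc n ℕ.+ tri i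
      index = ≡.trans (≡.cong (tri (suc (suc i)) ℕ.+_) (ℕₚ.∸-+-assoc n i i))
        (≡.trans (regroup (tri i) (n ∸ (i ℕ.+ i))) (≡.cong (λ m → suc m ℕ.+ tri i) (ℕₚ.m+[n∸m]≡n 2i≤n)))
    -- Truncated subtraction spoils the exponents here, but B is zero.
    ... | no 2i≰n = trans (*-congˡ zero!) (trans (zeroʳ _) (sym (trans (*-congˡ zero!) (zeroʳ _))))
      where zero! = binom-∸-zero n i (ℕₚ.≰⇒> 2i≰n)
  ... | no i≰n = begin
    gTerm (suc (suc n)) (suc i)            ≈⟨ gTerm-zero (suc (suc n)) (suc i) (≡.subst (suc (suc n) <_) (≡.sym (ℕₚ.+-suc (suc i) i)) (s<s (s<s (n<m⇒n<m+m n<i)))) ⟩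
    0#                                     ≈⟨ solve 1 (λ x → con (+ 0) := con (+ 0) :- x :* con (+ 0)) refl _ ⟩
    0# - q^ (suc n) * 0#                   ≈⟨ +-cong (gTerm-zero (suc n) (suc i) (n<m⇒n<m+m (s<s n<i))) (-‿cong (*-congˡ (aTerm-zero n i (n<m⇒n<m+m n<i)))) ⟨
    gTerm (suc n) (suc i) - q^ (suc n) * aTerm n i  ∎
    where n<i = ℕₚ.≰⇒> i≰n

  n<n+n+k : ∀ n k → n < suc k ℕ.+ n ℕ.+ (suc k ℕ.+ n)
  n<n+n+k n k = n<m⇒n<m+m (s≤s (ℕₚ.m≤n+m n k))

  ASum-difference : ∀ n → ASum (suc (suc n)) ≈ G (suc n) - G n
  ASum-difference n = begin
    sum (suc l) (aTerm (suc (suc n)))                            ≈⟨ sum-head l _ ⟩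
    gTerm (suc n) 0 + sum l (λ i → aTerm (suc (suc n)) (suc i))  ≈⟨ +-congˡ (trans (sum-cong l (λ i _ → aTerm-suc n i)) (sum-- l _ _)) ⟩
    gTerm (suc n) 0 + (sum l (λ i → gTerm (suc n) (suc i)) - sum l (gTerm n)) ≈⟨ +-assoc _ _ _ ⟨
    gTerm (suc n) 0 + sum l (λ i → gTerm (suc n) (suc i)) - sum l (gTerm n)   ≈⟨ +-congʳ (sum-head l (gTerm (suc n))) ⟨
    sum (suc l) (gTerm (suc n)) - sum l (gTerm n)                ≈⟨ +-cong (sum-gTerm (suc n) (suc l) (n<n+n+k (suc n) 1)) (-‿cong (sum-gTerm n l (n<n+n+k n 1))) ⟩
    G (suc n) - G n                                              ∎
    where l = suc (suc n)

  G-recurrence : ∀ n → G (suc (suc n)) ≈ G (suc n) - q^ (suc n) * ASum n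
  G-recurrence n = begin
    sum (suc l) (gTerm (suc (suc n)))                            ≈⟨ sum-head l _ ⟩
    gTerm (suc n) 0 + sum l (λ i → gTerm (suc (suc n)) (suc i))  ≈⟨ +-congˡ (trans (sum-cong l (λ i _ → gTerm-suc n i)) (sum-- l _ _)) ⟩
    gTerm (suc n) 0 + (sum l (λ i → gTerm (suc n) (suc i)) - sum l (λ i → q^ (suc n) * aTerm n i)) ≈⟨ +-assoc _ _ _ ⟨
    gTerm (suc n) 0 + sum l (λ i → gTerm (suc n) (suc i)) - sum l (λ i → q^ (suc n) * aTerm n i)   ≈⟨ +-cong (sum-head l (gTerm (suc n))) (-‿cong (*-sum l _ _)) ⟨
    sum (suc l) (gTerm (suc n)) - q^ (suc n) * sum l (aTerm n)   ≈⟨ +-cong (sum-gTerm (suc n) (suc l) (n<n+n+k (suc n) 1)) (-‿cong (*-congˡ (sum-aTerm n l (ℕₚ.n≤1+n _)))) ⟩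
    G (suc n) - q^ (suc n) * ASum n                              ∎
    where l = suc (suc n)

  G-0 : G 0 ≈ 1#
  G-0 = solve 0 (con (+ 0) :+ con (+ 1) :* con (+ 1) :* con (+ 1) := con (+ 1)) refl

  G-1 : G 1 ≈ 1#
  G-1 = solve 1 (λ x → con (+ 0) :+ con (+ 1) :* con (+ 1) :* con (+ 1) :+ x :* con (+ 0) := con (+ 1)) refl _

  -- Eliminating G between `ASum-difference` and `G-recurrence` leaves the three-step recurrence
  -- that defines `A`.
  ASum≈A : ∀ n → ASum n ≈ A n
  ASum≈A 0 = solve 0 (con (+ 0) :+ con (+ 1) :* con (+ 1) :* con (+ 1) := con (+ 1)) refl
  ASum≈A 1 = solve 1 (λ x → con (+ 0) :+ con (+ 1) :* con (+ 1) :* con (+ 1) :+ x :* con (+ 0) := con (+ 1)) refl _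
  ASum≈A 2 = trans (ASum-difference 0) (trans (+-cong G-1 (-‿cong G-0)) (-‿inverseʳ 1#))
  ASum≈A (suc (suc (suc n))) = begin
    ASum (suc (suc (suc n)))                                  ≈⟨ ASum-difference (suc n) ⟩
    G (suc (suc n)) - G (suc n)                               ≈⟨ +-congʳ (G-recurrence n) ⟩
    G (suc n) - q^ (suc n) * ASum n - G (suc n)               ≈⟨ solve 2 (λ g x → g :- x :- g := :- x) refl _ _ ⟩
    - (q^ (suc n) * ASum n)                                   ≈⟨ -‿cong (*-congˡ (ASum≈A n)) ⟩
    - (q^ (suc n) * A n)                                      ∎

  G-suc : ∀ n → G (suc n) - G n ≈ A (suc (suc n))
  G-suc n = trans (sym (ASum-difference n)) (ASum≈A (suc (suc n)))

  A-3s : ∀ s → A (s ℕ.* 3) ≈ sg s * q^ (pent s)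
  A-3s zero    = sym (*-identityˡ 1#)
  A-3s (suc s) = begin
    - (q^ (suc (s ℕ.* 3)) * A (s ℕ.* 3))                ≈⟨ -‿cong (*-congˡ (A-3s s)) ⟩
    - (q^ (suc (s ℕ.* 3)) * (sg s * q^ (pent s)))       ≈⟨ solve 3 (λ x s p → :- (x :* (s :* p)) := s :* (:- con (+ 1)) :* (p :* x)) refl _ _ _ ⟩
    sg (suc s) * (q^ (pent s) * q^ (suc (s ℕ.* 3)))     ≈⟨ *-congˡ (q^-*₂ (pent s) (suc (s ℕ.* 3)) ≡.refl) ⟩
    sg (suc s) * q^ (pent (suc s))                      ∎

  A-3s+1 : ∀ s → A (suc (s ℕ.* 3)) ≈ sg s * q^ (pent s ℕ.+ s)
  A-3s+1 zero    = sym (*-identityˡ 1#)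
  A-3s+1 (suc s) = begin
    - (q^ (suc (suc (s ℕ.* 3))) * A (suc (s ℕ.* 3)))            ≈⟨ -‿cong (*-congˡ (A-3s+1 s)) ⟩
    - (q^ (suc (suc (s ℕ.* 3))) * (sg s * q^ (pent s ℕ.+ s)))   ≈⟨ solve 3 (λ x s p → :- (x :* (s :* p)) := s :* (:- con (+ 1)) :* (p :* x)) refl _ _ _ ⟩
    sg (suc s) * (q^ (pent s ℕ.+ s) * q^ (suc (suc (s ℕ.* 3)))) ≈⟨ *-congˡ (q^-*₂ (pent s ℕ.+ s) (suc (suc (s ℕ.* 3))) (index (pent s))) ⟩
    sg (suc s) * q^ (pent (suc s) ℕ.+ suc s)                    ∎
    where
    index : ∀ p → p ℕ.+ s ℕ.+ suc (suc (s ℕ.* 3)) ≡ p ℕ.+ suc (s ℕ.* 3) ℕ.+ suc s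
    index p = ℕ-solve (p ∷ s ∷ [])

  A-3s+2 : ∀ s → A (suc (suc (s ℕ.* 3))) ≈ 0#
  A-3s+2 zero    = refl
  A-3s+2 (suc s) = trans (-‿cong (trans (*-congˡ (A-3s+2 s)) (zeroʳ _))) (solve 0 (:- con (+ 0) := con (+ 0)) refl)

  sg-even : ∀ r → sg (2 ℕ.* r) ≈ 1#
  sg-even r = begin
    sg (2 ℕ.* r)                ≡⟨ ≡.cong sg (ℕₚ.*-comm 2 r) ⟩
    sg (r ℕ.* 2)                ≈⟨ pow-* (- 1#) r 2 ⟩
    pow R (1# * - 1# * - 1#) r  ≈⟨ pow-cong r (solve 0 (con (+ 1) :* (:- con (+ 1)) :* (:- con (+ 1)) := con (+ 1)) refl) ⟩
    pow R 1# r                  ≈⟨ pow-1 r ⟩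
    1#                          ∎

  sg-even* : ∀ r x → sg (2 ℕ.* r) * x ≈ x
  sg-even* r x = trans (*-congʳ (sg-even r)) (*-identityˡ x)

  sg-odd* : ∀ r x → sg (suc (2 ℕ.* r)) * x ≈ - x
  sg-odd* r x = trans (sg-suc* (2 ℕ.* r) x) (-‿cong (sg-even* r x))

  -- For k = 3r and k = 3r + 2, one of the indices 2k + 1, 2k + 2 is 2 modulo 3 and contributes
  -- nothing. For k = 3r + 1 both survive, with odd s = 2r + 1: hence the two negative terms of α_k.
  alphaRJ-A : ∀ r j → j < 3 → let n = suc (2 ℕ.* (j ℕ.+ r ℕ.* 3)) in alphaRJ R q r j ≈ A n + A (suc n)
  alphaRJ-A r 0 _ = begin
    q^ (6 ℕ.* r ℕ.* r ℕ.+ r)                                ≈⟨ q^-≡ index ⟨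
    q^ (pent (2 ℕ.* r) ℕ.+ 2 ℕ.* r)                         ≈⟨ sg-even* r _ ⟨
    sg (2 ℕ.* r) * q^ (pent (2 ℕ.* r) ℕ.+ 2 ℕ.* r)          ≈⟨ A-3s+1 (2 ℕ.* r) ⟨
    A (suc (2 ℕ.* r ℕ.* 3))                                 ≈⟨ trans (+-congˡ (A-3s+2 (2 ℕ.* r))) (+-identityʳ _) ⟨
    A (suc (2 ℕ.* r ℕ.* 3)) + A (suc (suc (2 ℕ.* r ℕ.* 3))) ≡⟨ ≡.cong (λ n → A (suc n) + A (suc (suc n))) (ℕₚ.*-assoc 2 r 3) ⟩
    A (suc (2 ℕ.* (r ℕ.* 3))) + A (suc (suc (2 ℕ.* (r ℕ.* 3)))) ∎
    where
    regroup : ∀ p → p ℕ.+ 2 ℕ.* r ≡ p ℕ.+ r ℕ.+ r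
    regroup p = ℕ-solve (p ∷ r ∷ [])
    index : pent (2 ℕ.* r) ℕ.+ 2 ℕ.* r ≡ 6 ℕ.* r ℕ.* r ℕ.+ r
    index = ≡.trans (regroup (pent (2 ℕ.* r))) (≡.cong (ℕ._+ r) (pent-even r))
  alphaRJ-A r 1 _ = begin
    - q^ (6 ℕ.* r ℕ.* r ℕ.+ 5 ℕ.* r ℕ.+ 1) - q^ (6 ℕ.* r ℕ.* r ℕ.+ 7 ℕ.* r ℕ.+ 2)
      ≈⟨ +-cong (-‿cong (q^-≡ index₁)) (-‿cong (q^-≡ index₂)) ⟨
    - q^ (pent s) - q^ (pent s ℕ.+ s)
      ≈⟨ +-cong (sg-odd* r _) (sg-odd* r _) ⟨
    sg s * q^ (pent s) + sg s * q^ (pent s ℕ.+ s)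
      ≈⟨ +-cong (A-3s s) (A-3s+1 s) ⟨
    A (s ℕ.* 3) + A (suc (s ℕ.* 3))
      ≡⟨ ≡.cong (λ n → A n + A (suc n)) index ⟩
    A (suc (2 ℕ.* (1 ℕ.+ r ℕ.* 3))) + A (suc (suc (2 ℕ.* (1 ℕ.+ r ℕ.* 3)))) ∎
    where
    s = suc (2 ℕ.* r)
    index : suc (2 ℕ.* r) ℕ.* 3 ≡ suc (2 ℕ.* (1 ℕ.+ r ℕ.* 3))
    index = ℕ-solve (r ∷ [])
    index₁ : pent s ≡ 6 ℕ.* r ℕ.* r ℕ.+ 5 ℕ.* r ℕ.+ 1
    index₁ = ≡.trans (pent-odd r) product
      where
      product : suc (2 ℕ.* r) ℕ.* suc (r ℕ.* 3) ≡ 6 ℕ.* r ℕ.* r ℕ.+ 5 ℕ.* r ℕ.+ 1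
      product = ℕ-solve (r ∷ [])
    regroup₂ : ∀ x → x ℕ.+ 5 ℕ.* r ℕ.+ 1 ℕ.+ suc (2 ℕ.* r) ≡ x ℕ.+ 7 ℕ.* r ℕ.+ 2
    regroup₂ x = ℕ-solve (x ∷ r ∷ [])
    index₂ : pent s ℕ.+ s ≡ 6 ℕ.* r ℕ.* r ℕ.+ 7 ℕ.* r ℕ.+ 2
    index₂ = ≡.trans (≡.cong (ℕ._+ s) index₁) (regroup₂ (6 ℕ.* r ℕ.* r))
  alphaRJ-A r 2 _ = begin
    q^ (6 ℕ.* suc r ℕ.* suc r ∸ suc r)                  ≈⟨ q^-≡ index ⟨
    q^ (pent (2 ℕ.* suc r))                             ≈⟨ sg-even* (suc r) _ ⟨
    sg (2 ℕ.* suc r) * q^ (pent (2 ℕ.* suc r))          ≈⟨ A-3s (2 ℕ.* suc r) ⟨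
    A (2 ℕ.* suc r ℕ.* 3)                               ≈⟨ trans (+-congʳ (A-3s+2 (suc (2 ℕ.* r)))) (+-identityˡ _) ⟨
    A (suc (suc (suc (2 ℕ.* r) ℕ.* 3))) + A (2 ℕ.* suc r ℕ.* 3)
      ≡⟨ ≡.cong₂ (λ m n → A m + A n) index₁ index₂ ⟩
    A (suc (2 ℕ.* (2 ℕ.+ r ℕ.* 3))) + A (suc (suc (2 ℕ.* (2 ℕ.+ r ℕ.* 3)))) ∎
    where
    index : pent (2 ℕ.* suc r) ≡ 6 ℕ.* suc r ℕ.* suc r ∸ suc r
    index = ≡.trans (≡.sym (ℕₚ.m+n∸n≡m (pent (2 ℕ.* suc r)) (suc r))) (≡.cong (_∸ suc r) (pent-even (suc r)))
    index₁ : suc (suc (suc (2 ℕ.* r) ℕ.* 3)) ≡ suc (2 ℕ.* (2 ℕ.+ r ℕ.* 3))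
    index₁ = ℕ-solve (r ∷ [])
    index₂ : 2 ℕ.* suc r ℕ.* 3 ≡ suc (suc (2 ℕ.* (2 ℕ.+ r ℕ.* 3)))
    index₂ = ℕ-solve (r ∷ [])
  alphaRJ-A r (suc (suc (suc _))) (s≤s (s≤s (s≤s ())))

  alpha-A : ∀ k → alpha R q k ≈ A (suc (2 ℕ.* k)) + A (suc (suc (2 ℕ.* k)))
  alpha-A k = ≡.subst (λ m → alpha R q k ≈ A (suc (2 ℕ.* m)) + A (suc (suc (2 ℕ.* m))))
    (≡.sym (ℕ÷.m≡m%n+[m/n]*n k 3)) (alphaRJ-A (k ℕ./ 3) (k ℕ.% 3) (ℕ÷.m%n<n k 3))

-- Arithmetic of the exponents.

parity : ∀ n → (∃ λ m → n ≡ 2 ℕ.* m) ⊎ (∃ λ m → n ≡ suc (2 ℕ.* m))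
parity zero = inj₁ (0 , ≡.refl)
parity (suc n) with parity n
... | inj₁ (m , ≡.refl) = inj₂ (m , ≡.refl)
... | inj₂ (m , ≡.refl) = inj₁ (suc m , index)
  where
  index : suc (suc (2 ℕ.* m)) ≡ 2 ℕ.* suc m
  index = ℕ-solve (m ∷ [])

tri-double : ∀ k → 2 ℕ.* tri (suc k) ≡ k ℕ.* k ℕ.+ k
tri-double zero    = ≡.refl
tri-double (suc k) = ≡.trans (regroup (tri (suc k))) (≡.trans (≡.cong (ℕ._+ 2 ℕ.* suc k) (tri-double k)) index)
  where
  regroup : ∀ t → 2 ℕ.* (t ℕ.+ suc k) ≡ 2 ℕ.* t ℕ.+ 2 ℕ.* suc k
  regroup t = ℕ-solve (t ∷ k ∷ [])
  index : k ℕ.* k ℕ.+ k ℕ.+ 2 ℕ.* suc k ≡ suc k ℕ.* suc k ℕ.+ suc k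
  index = ℕ-solve (k ∷ [])

tri-+ : ∀ k n → tri (suc (k ℕ.+ n)) ≡ tri (suc k) ℕ.+ (k ℕ.* n ℕ.+ tri (suc n))
tri-+ k n = ℕₚ.*-cancelˡ-≡ _ _ 2 (begin
  2 ℕ.* tri (suc (k ℕ.+ n))                                       ≡⟨ tri-double (k ℕ.+ n) ⟩
  (k ℕ.+ n) ℕ.* (k ℕ.+ n) ℕ.+ (k ℕ.+ n)                           ≡⟨ ℕ-solve (k ∷ n ∷ []) ⟩
  (k ℕ.* k ℕ.+ k) ℕ.+ (2 ℕ.* (k ℕ.* n) ℕ.+ (n ℕ.* n ℕ.+ n))       ≡⟨ ≡.cong₂ (λ x y → x ℕ.+ (2 ℕ.* (k ℕ.* n) ℕ.+ y)) (tri-double k) (tri-double n) ⟨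
  2 ℕ.* tri (suc k) ℕ.+ (2 ℕ.* (k ℕ.* n) ℕ.+ 2 ℕ.* tri (suc n))   ≡⟨ regroup (tri (suc k)) (k ℕ.* n) (tri (suc n)) ⟩
  2 ℕ.* (tri (suc k) ℕ.+ (k ℕ.* n ℕ.+ tri (suc n)))               ∎)
  where
  open ≡.≡-Reasoning
  regroup : ∀ a b c → 2 ℕ.* a ℕ.+ (2 ℕ.* b ℕ.+ 2 ℕ.* c) ≡ 2 ℕ.* (a ℕ.+ (b ℕ.+ c))
  regroup a b c = ℕ-solve (a ∷ b ∷ c ∷ [])

tri-/2 : ∀ k → (suc k ℕ.* k) ℕ./ 2 ≡ tri (suc k)
tri-/2 k = ≡.trans (≡.cong (ℕ._/ 2) index) (ℕ÷.m*n/n≡m (tri (suc k)) 2)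
  where
  index : suc k ℕ.* k ≡ tri (suc k) ℕ.* 2
  index = ≡.trans (ℕₚ.+-comm k (k ℕ.* k)) (≡.trans (≡.sym (tri-double k)) (ℕₚ.*-comm 2 (tri (suc k))))

-- For N = 3s + 1 the doubled exponent is sN, which is the form `sg-q^-half` asks for; `pent-half₂`
-- does the same for N = 3s + 2.
pent-half₁ : ∀ s → 2 ℕ.* (pent s ℕ.+ s) ≡ s ℕ.* suc (s ℕ.* 3)
pent-half₁ s = ≡.trans (regroup (pent s)) (≡.trans (≡.cong (ℕ._+ s) (pent-double s)) index)
  where
  regroup : ∀ p → 2 ℕ.* (p ℕ.+ s) ≡ 2 ℕ.* p ℕ.+ s ℕ.+ s
  regroup p = ℕ-solve (p ∷ s ∷ [])
  index : 3 ℕ.* (s ℕ.* s) ℕ.+ s ≡ s ℕ.* suc (s ℕ.* 3)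
  index = ℕ-solve (s ∷ [])

pent-half₂ : ∀ s → 2 ℕ.* pent (suc s) ≡ suc s ℕ.* suc (suc (s ℕ.* 3))
pent-half₂ s = ℕₚ.+-cancelʳ-≡ (suc s) _ _ (≡.trans (pent-double (suc s)) index)
  where
  index : 3 ℕ.* (suc s ℕ.* suc s) ≡ suc s ℕ.* suc (suc (s ℕ.* 3)) ℕ.+ suc s
  index = ℕ-solve (s ∷ [])

-- Relations among the values of A at a root of unity.

module AtRoot {c ℓ : Level} (R : CommutativeRing c ℓ)
  (domain : IsIntegralDomain R) (charZero : CharZero R)
  (N : ℕ) (1≤N : 1 ≤ N) (q : CommutativeRing.Carrier R) (primRoot : IsPrimitiveRoot R N q) where
  open CommutativeRing R hiding (zero)
  open RingSolver R
  open Sums R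
  open QSeries R q
  open BaileyPairs R q
  open BaileyChain R domain charZero N q primRoot
  open CiglerSums R q
  open Algebra.Properties.Ring ring using (x∙y⁻¹≈ε⇒x≈y)
  open Relation.Binary.Reasoning.Setoid setoid

  q^N≈1 : q^ N ≈ 1#
  q^N≈1 = proj₁ primRoot

  q^-root : ∀ m c → m ≡ c ℕ.* N → q^ m ≈ 1#
  q^-root _ c ≡.refl = trans (pow-* q c N) (trans (pow-cong c q^N≈1) (pow-1 c))

  q^-shift : ∀ a c {m} → m ≡ a ℕ.+ c ℕ.* N → q^ m ≈ q^ a
  q^-shift a c ≡.refl = trans (pow-+ q a (c ℕ.* N)) (trans (*-congˡ (q^-root _ c ≡.refl)) (*-identityʳ _))

  neg≈ : ∀ {x y} → x + y ≈ 0# → x ≈ - y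
  neg≈ {x} {y} x+y≈0 = x∙y⁻¹≈ε⇒x≈y x (- y) (trans (solve 2 (λ x y → x :- (:- y) := x :+ y) refl _ _) x+y≈0)

  -- q^h squares to 1, and 0 < h < N keeps it from being 1, so in a domain it is -1.
  q^-half : ∀ h → N ≡ 2 ℕ.* h → q^ h ≈ - 1#
  q^-half zero N≡0 = ⊥-elim (ℕₚ.<⇒≢ 1≤N (≡.sym N≡0))
  q^-half h@(suc h′) N≡2h = neg≈ (zero-cancel (1-q^-nonzero h z<s h<N) (begin
    (1# - q^ h) * (q^ h + 1#)   ≈⟨ solve 1 (λ x → (con (+ 1) :- x) :* (x :+ con (+ 1)) := con (+ 1) :- x :* x) refl _ ⟩
    1# - q^ h * q^ h            ≈⟨ +-congˡ (-‿cong (trans (q^-*₂ h h (≡.sym (≡.trans N≡2h (≡.cong (h ℕ.+_) (ℕₚ.+-identityʳ h))))) q^N≈1)) ⟩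
    1# - 1#                     ≈⟨ -‿inverseʳ 1# ⟩
    0#                          ∎))
    where
    h<N : h < N
    h<N = ≡.subst (h <_) (≡.sym N≡2h) (ℕₚ.m<m+n h z<s)

  -- Formally (-1)^n q^{nN/2} = 1, whatever the parities of n and N.
  sg-q^-half : ∀ n e → 2 ℕ.* e ≡ n ℕ.* N → sg n * q^ e ≈ 1#
  sg-q^-half n e 2e≡nN with parity n
  ... | inj₁ (t , ≡.refl) = trans (sg-even* t _) (q^-root e t (ℕₚ.*-cancelˡ-≡ e (t ℕ.* N) 2 (≡.trans 2e≡nN (ℕₚ.*-assoc 2 t N))))
  -- For odd n, the equation 2e = nN forces N to be even, and q^{N/2} = -1 supplies the second sign.
  ... | inj₂ (t , ≡.refl) with parity N
  ...   | inj₁ (h , N≡2h) = begin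
    sg n * q^ e                     ≈⟨ *-congˡ (q^-≡ e≡nh) ⟩
    sg n * q^ (n ℕ.* h)             ≈⟨ *-congˡ (trans (pow-* q n h) (pow-cong n (q^-half h N≡2h))) ⟩
    sg n * sg n                     ≈⟨ sg-odd* t _ ⟩
    - sg n                          ≈⟨ -‿cong (trans (sym (*-identityʳ _)) (sg-odd* t 1#)) ⟩
    - - 1#                          ≈⟨ solve 0 (:- (:- con (+ 1)) := con (+ 1)) refl ⟩
    1#                              ∎
    where
    e≡nh : e ≡ n ℕ.* h
    e≡nh = ℕₚ.*-cancelˡ-≡ e (n ℕ.* h) 2 (≡.trans 2e≡nN (≡.trans (≡.cong (n ℕ.*_) N≡2h) (regroup n)))
      where
      regroup : ∀ n → n ℕ.* (2 ℕ.* h) ≡ 2 ℕ.* (n ℕ.* h)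
      regroup n = ℕ-solve (n ∷ h ∷ [])
  ...   | inj₂ (h , N≡1+2h) = ⊥-elim (ℕₚ.even≢odd e (2 ℕ.* t ℕ.* h ℕ.+ t ℕ.+ h) (≡.trans 2e≡nN (≡.trans (≡.cong (n ℕ.*_) N≡1+2h) index)))
    where
    index : suc (2 ℕ.* t) ℕ.* suc (2 ℕ.* h) ≡ suc (2 ℕ.* (2 ℕ.* t ℕ.* h ℕ.+ t ℕ.+ h))
    index = ℕ-solve (t ∷ h ∷ [])

  -- Raising a by 3 multiplies its value by -q^{a+1}; lowering b by 3 divides both other values by
  -- -q^{b+1}, as q^N = 1. The two factors multiply to q^N = 1, so the relation persists.
  A-step : ∀ a b → suc a ℕ.+ suc b ≡ N →
    A a + A (suc (suc (suc b)) ℕ.+ N) ≈ A (suc (suc (suc b))) →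
    A (suc (suc (suc a))) + A (b ℕ.+ N) ≈ A b
  A-step a b 2+a+b≡N ih = begin
    - (x * A a) + A (b ℕ.+ N)
      ≈⟨ +-congʳ (-‿cong (*-congˡ A-a)) ⟩
    - (x * (- (y * A b) - - (q^ (suc (b ℕ.+ N)) * A (b ℕ.+ N)))) + A (b ℕ.+ N)
      ≈⟨ +-congʳ (-‿cong (*-congˡ (+-congˡ (-‿cong (-‿cong (*-congʳ q^-drop)))))) ⟩
    - (x * (- (y * A b) - - (y * A (b ℕ.+ N)))) + A (b ℕ.+ N)
      ≈⟨ solve 4 (λ x y u v → :- (x :* (:- (y :* u) :- (:- (y :* v)))) :+ v := x :* y :* (u :- v) :+ v) refl _ _ _ _ ⟩
    x * y * (A b - A (b ℕ.+ N)) + A (b ℕ.+ N)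
      ≈⟨ +-congʳ (*-congʳ (trans (q^-*₂ (suc a) (suc b) 2+a+b≡N) q^N≈1)) ⟩
    1# * (A b - A (b ℕ.+ N)) + A (b ℕ.+ N)
      ≈⟨ solve 2 (λ u v → con (+ 1) :* (u :- v) :+ v := u) refl _ _ ⟩
    A b ∎
    where
    x = q^ (suc a)
    y = q^ (suc b)
    A-a : A a ≈ A (suc (suc (suc b))) - A (suc (suc (suc b)) ℕ.+ N)
    A-a = trans (solve 2 (λ u v → u := u :+ v :- v) refl _ _) (+-congʳ ih)
    q^-drop : q^ (suc (b ℕ.+ N)) ≈ y
    q^-drop = q^-shift (suc b) 1 (≡.cong (suc b ℕ.+_) (≡.sym (ℕₚ.+-identityʳ N)))

  A-even-3s : ∀ s → A (2 ℕ.* s ℕ.* 3) ≈ q^ (pent (2 ℕ.* s))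
  A-even-3s s = trans (A-3s (2 ℕ.* s)) (sg-even* s _)

  A-even-3s+1 : ∀ s → A (suc (2 ℕ.* s ℕ.* 3)) ≈ q^ (6 ℕ.* s ℕ.* s ℕ.+ s)
  A-even-3s+1 s = trans (A-3s+1 (2 ℕ.* s)) (trans (sg-even* s _) (q^-≡ (≡.trans (regroup (pent (2 ℕ.* s))) (≡.cong (ℕ._+ s) (pent-even s)))))
    where
    regroup : ∀ p → p ℕ.+ 2 ℕ.* s ≡ p ℕ.+ s ℕ.+ s
    regroup p = ℕ-solve (p ∷ s ∷ [])

  A-odd-3s : ∀ s → A (suc (2 ℕ.* s) ℕ.* 3) ≈ - q^ (suc (2 ℕ.* s) ℕ.* suc (s ℕ.* 3))
  A-odd-3s s = trans (A-3s (suc (2 ℕ.* s))) (trans (sg-odd* s _) (-‿cong (q^-≡ (pent-odd s))))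

  A-odd-3s+1 : ∀ s → A (suc (suc (2 ℕ.* s) ℕ.* 3)) ≈ - q^ (suc (2 ℕ.* s) ℕ.* suc (suc (s ℕ.* 3)))
  A-odd-3s+1 s = trans (A-3s+1 (suc (2 ℕ.* s))) (trans (sg-odd* s _) (-‿cong (q^-≡ (≡.trans (≡.cong (ℕ._+ suc (2 ℕ.* s)) (pent-odd s)) index))))
    where
    index : suc (2 ℕ.* s) ℕ.* suc (s ℕ.* 3) ℕ.+ suc (2 ℕ.* s) ≡ suc (2 ℕ.* s) ℕ.* suc (suc (s ℕ.* 3))
    index = ℕ-solve (s ∷ [])

  1-1≈0 : 1# + - 1# ≈ 0#
  1-1≈0 = -‿inverseʳ 1#

  module N≡0[mod3] (s′ : ℕ) (N≡3s : N ≡ suc s′ ℕ.* 3) where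
    s : ℕ
    s = suc s′
    ω : Carrier
    ω = q^ s

    ω³≈1 : ω * ω * ω ≈ 1#
    ω³≈1 = trans (q^-*₃ s s s (≡.trans index (≡.sym N≡3s))) q^N≈1
      where
      index : suc s′ ℕ.+ suc s′ ℕ.+ suc s′ ≡ suc s′ ℕ.* 3
      index = ℕ-solve (s′ ∷ [])

    -- ω is a cube root of unity, and 0 < s < N makes it different from 1. When 3 divides N, the
    -- terms of `A-base₀` and `A-base₁` are 1, ω, ω² up to sign, and this is the relation that
    -- balances them.
    1+ω+ω²≈0 : 1# + ω + ω * ω ≈ 0#
    1+ω+ω²≈0 = zero-cancel (1-q^-nonzero s z<s s<N) (begin
      (1# - ω) * (1# + ω + ω * ω)   ≈⟨ solve 1 (λ w → (con (+ 1) :- w) :* (con (+ 1) :+ w :+ w :* w) := con (+ 1) :- w :* w :* w) refl _ ⟩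
      1# - ω * ω * ω                ≈⟨ +-congˡ (-‿cong ω³≈1) ⟩
      1# - 1#                       ≈⟨ -‿inverseʳ 1# ⟩
      0#                            ∎)
      where
      s<N : s < N
      s<N = ≡.subst (s <_) (≡.sym N≡3s) (ℕₚ.m<m*n s 3 (s<s z<s))

    A-N : A (s ℕ.* 3) ≈ - ω
    A-N = begin
      A (s ℕ.* 3)                          ≈⟨ A-3s s ⟩
      κ                                    ≈⟨ *-identityʳ _ ⟨
      -- Two of the three inserted ω raise the exponent to `pent s` + 2s, whose double is (s + 1)N;
      -- the third remains as the value.
      κ * 1#                               ≈⟨ *-congˡ ω³≈1 ⟨
      κ * (ω * ω * ω)                      ≈⟨ solve 3 (λ s p w → s :* p :* (w :* w :* w) := :- (s :* (:- con (+ 1)) :* (p :* w :* w) :* w)) refl _ _ _ ⟩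
      - (sg (suc s) * (q^ (pent s) * ω * ω) * ω) ≈⟨ -‿cong (*-congʳ (*-congˡ (q^-*₃ (pent s) s s ≡.refl))) ⟩
      - (sg (suc s) * q^ (pent s ℕ.+ s ℕ.+ s) * ω) ≈⟨ -‿cong (*-congʳ (sg-q^-half (suc s) (pent s ℕ.+ s ℕ.+ s) index)) ⟩
      - (1# * ω)                           ≈⟨ -‿cong (*-identityˡ ω) ⟩
      - ω                                  ∎
      where
      κ = sg s * q^ (pent s)
      regroup : ∀ p s → 2 ℕ.* (p ℕ.+ s ℕ.+ s) ≡ 2 ℕ.* p ℕ.+ s ℕ.+ 3 ℕ.* s
      regroup p s = ℕ-solve (p ∷ s ∷ [])
      regroup′ : ∀ s → 3 ℕ.* (s ℕ.* s) ℕ.+ 3 ℕ.* s ≡ suc s ℕ.* (s ℕ.* 3)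
      regroup′ s = ℕ-solve (s ∷ [])
      index : 2 ℕ.* (pent s ℕ.+ s ℕ.+ s) ≡ suc s ℕ.* N
      index = ≡.trans (regroup (pent s) s) (≡.trans (≡.cong (ℕ._+ 3 ℕ.* s) (pent-double s))
        (≡.trans (regroup′ s) (≡.cong (suc s ℕ.*_) (≡.sym N≡3s))))

    A-N+1 : A (suc (s ℕ.* 3)) ≈ - (ω * ω)
    A-N+1 = begin
      A (suc (s ℕ.* 3))              ≈⟨ A-3s+1 s ⟩
      sg s * q^ (pent s ℕ.+ s)       ≈⟨ *-congˡ (pow-+ q (pent s) s) ⟩
      sg s * (q^ (pent s) * ω)       ≈⟨ *-assoc _ _ _ ⟨
      sg s * q^ (pent s) * ω         ≈⟨ *-congʳ (trans (sym (A-3s s)) A-N) ⟩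
      - ω * ω                        ≈⟨ solve 1 (λ w → (:- w) :* w := :- (w :* w)) refl _ ⟩
      - (ω * ω)                      ∎

    A-2N : A (2 ℕ.* s ℕ.* 3) ≈ ω * ω
    A-2N = begin
      A (2 ℕ.* s ℕ.* 3)                     ≈⟨ A-even-3s s ⟩
      q^ (pent (2 ℕ.* s))                   ≈⟨ *-identityʳ _ ⟨
      q^ (pent (2 ℕ.* s)) * 1#              ≈⟨ *-congˡ ω³≈1 ⟨
      q^ (pent (2 ℕ.* s)) * (ω * ω * ω)     ≈⟨ solve 2 (λ p w → p :* (w :* w :* w) := p :* w :* (w :* w)) refl _ _ ⟩
      q^ (pent (2 ℕ.* s)) * ω * (ω * ω)     ≈⟨ *-congʳ (trans (q^-*₂ (pent (2 ℕ.* s)) s (pent-even s)) (q^-root _ (2 ℕ.* s) index)) ⟩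
      1# * (ω * ω)                          ≈⟨ *-identityˡ _ ⟩
      ω * ω                                 ∎
      where
      regroup : ∀ s → 6 ℕ.* s ℕ.* s ≡ 2 ℕ.* s ℕ.* (s ℕ.* 3)
      regroup s = ℕ-solve (s ∷ [])
      index : 6 ℕ.* s ℕ.* s ≡ 2 ℕ.* s ℕ.* N
      index = ≡.trans (regroup s) (≡.cong (2 ℕ.* s ℕ.*_) (≡.sym N≡3s))

    A-2N+1 : A (suc (2 ℕ.* s ℕ.* 3)) ≈ ω
    A-2N+1 = trans (A-even-3s+1 s) (q^-shift s (2 ℕ.* s) (≡.trans (regroup s) (≡.cong (λ n → s ℕ.+ 2 ℕ.* s ℕ.* n) (≡.sym N≡3s))))
      where
      regroup : ∀ s → 6 ℕ.* s ℕ.* s ℕ.+ s ≡ s ℕ.+ 2 ℕ.* s ℕ.* (s ℕ.* 3)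
      regroup s = ℕ-solve (s ∷ [])

  -- Steps of three leave a = 0, 1, 2 as starting points, settled from the closed forms for each
  -- residue of N modulo 3. If 3 does not divide N, one of the three terms has index 2 modulo 3 and
  -- drops out; the exponents of the other two agree up to multiples of N/2.
  A-base₀ : A 0 + A (suc N ℕ.+ N) ≈ A (suc N)
  A-base₁ : A 1 + A (N ℕ.+ N) ≈ A N
  A-base₂ : ∀ b → suc b ≡ N → A 2 + A (b ℕ.+ N) ≈ A b

  mod3 : ∃ λ s → (N ≡ suc s ℕ.* 3) ⊎ (N ≡ suc (s ℕ.* 3)) ⊎ (N ≡ suc (suc (s ℕ.* 3)))
  mod3 = go N 1≤N
    where
    go : ∀ n → 1 ≤ n → ∃ λ s → (n ≡ suc s ℕ.* 3) ⊎ (n ≡ suc (s ℕ.* 3)) ⊎ (n ≡ suc (suc (s ℕ.* 3)))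
    go 1 _ = 0 , inj₂ (inj₁ ≡.refl)
    go 2 _ = 0 , inj₂ (inj₂ ≡.refl)
    go 3 _ = 0 , inj₁ ≡.refl
    go (suc (suc (suc n@(suc _)))) _ with go n z<s
    ... | s , inj₁ ≡.refl        = suc s , inj₁ ≡.refl
    ... | s , inj₂ (inj₁ ≡.refl) = suc s , inj₂ (inj₁ ≡.refl)
    ... | s , inj₂ (inj₂ ≡.refl) = suc s , inj₂ (inj₂ ≡.refl)

  A-base₀ with mod3
  ... | s′ , inj₁ N≡3s = begin
    1# + A (suc N ℕ.+ N)                    ≡⟨ ≡.cong (λ n → 1# + A n) index ⟩
    1# + A (suc (2 ℕ.* s ℕ.* 3))            ≈⟨ +-congˡ A-2N+1 ⟩
    1# + ω                                  ≈⟨ neg≈ 1+ω+ω²≈0 ⟩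
    - (ω * ω)                               ≈⟨ A-N+1 ⟨
    A (suc (s ℕ.* 3))                       ≡⟨ ≡.cong (λ n → A (suc n)) N≡3s ⟨
    A (suc N)                               ∎
    where
    open N≡0[mod3] s′ N≡3s
    regroup : ∀ s → suc (s ℕ.* 3) ℕ.+ s ℕ.* 3 ≡ suc (2 ℕ.* s ℕ.* 3)
    regroup s = ℕ-solve (s ∷ [])
    index : suc N ℕ.+ N ≡ suc (2 ℕ.* s ℕ.* 3)
    index = ≡.trans (≡.cong (λ n → suc n ℕ.+ n) N≡3s) (regroup s)
  ... | s , inj₂ (inj₁ N≡3s+1) = begin
    1# + A (suc N ℕ.+ N)                    ≡⟨ ≡.cong (λ n → 1# + A n) (≡.trans (≡.cong (λ n → suc n ℕ.+ n) N≡3s+1) index) ⟩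
    1# + A (suc (2 ℕ.* s) ℕ.* 3)            ≈⟨ +-congˡ (trans (A-odd-3s s) (-‿cong (q^-root _ (suc (2 ℕ.* s)) (≡.cong (suc (2 ℕ.* s) ℕ.*_) (≡.sym N≡3s+1))))) ⟩
    1# + - 1#                               ≈⟨ 1-1≈0 ⟩
    0#                                      ≈⟨ A-3s+2 s ⟨
    A (suc (suc (s ℕ.* 3)))                 ≡⟨ ≡.cong (λ n → A (suc n)) N≡3s+1 ⟨
    A (suc N)                               ∎
    where
    index : suc (suc (s ℕ.* 3)) ℕ.+ suc (s ℕ.* 3) ≡ suc (2 ℕ.* s) ℕ.* 3
    index = ℕ-solve (s ∷ [])
  ... | s , inj₂ (inj₂ N≡3s+2) = begin
    1# + A (suc N ℕ.+ N)                    ≡⟨ ≡.cong (λ n → 1# + A n) (≡.trans (≡.cong (λ n → suc n ℕ.+ n) N≡3s+2) index) ⟩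
    1# + A (suc (suc (suc (2 ℕ.* s) ℕ.* 3))) ≈⟨ +-congˡ (A-3s+2 (suc (2 ℕ.* s))) ⟩
    1# + 0#                                 ≈⟨ +-identityʳ 1# ⟩
    1#                                      ≈⟨ sg-q^-half (suc s) (pent (suc s)) (≡.trans (pent-half₂ s) (≡.cong (suc s ℕ.*_) (≡.sym N≡3s+2))) ⟨
    sg (suc s) * q^ (pent (suc s))          ≈⟨ A-3s (suc s) ⟨
    A (suc s ℕ.* 3)                         ≡⟨ ≡.cong (λ n → A (suc n)) N≡3s+2 ⟨
    A (suc N)                               ∎
    where
    index : suc (suc (suc (s ℕ.* 3))) ℕ.+ suc (suc (s ℕ.* 3)) ≡ suc (suc (suc (2 ℕ.* s) ℕ.* 3))
    index = ℕ-solve (s ∷ [])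

  A-base₁ with mod3
  ... | s′ , inj₁ N≡3s = begin
    1# + A (N ℕ.+ N)                        ≡⟨ ≡.cong (λ n → 1# + A n) index ⟩
    1# + A (2 ℕ.* s ℕ.* 3)                  ≈⟨ +-congˡ A-2N ⟩
    1# + ω * ω                              ≈⟨ neg≈ (trans (solve 1 (λ w → con (+ 1) :+ w :* w :+ w := con (+ 1) :+ w :+ w :* w) refl _) 1+ω+ω²≈0) ⟩
    - ω                                     ≈⟨ A-N ⟨
    A (s ℕ.* 3)                             ≡⟨ ≡.cong A N≡3s ⟨
    A N                                     ∎
    where
    open N≡0[mod3] s′ N≡3s
    regroup : ∀ s → s ℕ.* 3 ℕ.+ s ℕ.* 3 ≡ 2 ℕ.* s ℕ.* 3
    regroup s = ℕ-solve (s ∷ [])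
    index : N ℕ.+ N ≡ 2 ℕ.* s ℕ.* 3
    index = ≡.trans (≡.cong (λ n → n ℕ.+ n) N≡3s) (regroup s)
  ... | s , inj₂ (inj₁ N≡3s+1) = begin
    1# + A (N ℕ.+ N)                        ≡⟨ ≡.cong (λ n → 1# + A n) (≡.trans (≡.cong (λ n → n ℕ.+ n) N≡3s+1) index) ⟩
    1# + A (suc (suc (2 ℕ.* s ℕ.* 3)))      ≈⟨ +-congˡ (A-3s+2 (2 ℕ.* s)) ⟩
    1# + 0#                                 ≈⟨ +-identityʳ 1# ⟩
    1#                                      ≈⟨ sg-q^-half s (pent s ℕ.+ s) (≡.trans (pent-half₁ s) (≡.cong (s ℕ.*_) (≡.sym N≡3s+1))) ⟨
    sg s * q^ (pent s ℕ.+ s)                ≈⟨ A-3s+1 s ⟨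
    A (suc (s ℕ.* 3))                       ≡⟨ ≡.cong A N≡3s+1 ⟨
    A N                                     ∎
    where
    index : suc (s ℕ.* 3) ℕ.+ suc (s ℕ.* 3) ≡ suc (suc (2 ℕ.* s ℕ.* 3))
    index = ℕ-solve (s ∷ [])
  ... | s , inj₂ (inj₂ N≡3s+2) = begin
    1# + A (N ℕ.+ N)                        ≡⟨ ≡.cong (λ n → 1# + A n) (≡.trans (≡.cong (λ n → n ℕ.+ n) N≡3s+2) index) ⟩
    1# + A (suc (suc (2 ℕ.* s) ℕ.* 3))      ≈⟨ +-congˡ (trans (A-odd-3s+1 s) (-‿cong (q^-root _ (suc (2 ℕ.* s)) (≡.cong (suc (2 ℕ.* s) ℕ.*_) (≡.sym N≡3s+2))))) ⟩
    1# + - 1#                               ≈⟨ 1-1≈0 ⟩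
    0#                                      ≈⟨ A-3s+2 s ⟨
    A (suc (suc (s ℕ.* 3)))                 ≡⟨ ≡.cong A N≡3s+2 ⟨
    A N                                     ∎
    where
    index : suc (suc (s ℕ.* 3)) ℕ.+ suc (suc (s ℕ.* 3)) ≡ suc (suc (2 ℕ.* s) ℕ.* 3)
    index = ℕ-solve (s ∷ [])

  A-base₂ b 1+b≡N with mod3
  ... | s′ , inj₁ N≡3s = begin
    0# + A (b ℕ.+ N)                        ≈⟨ +-identityˡ _ ⟩
    A (b ℕ.+ N)                             ≡⟨ ≡.cong A (≡.trans (≡.cong₂ ℕ._+_ b≡ N≡3s) index) ⟩
    A (suc (suc ((s′ ℕ.+ suc s′) ℕ.* 3)))   ≈⟨ A-3s+2 (s′ ℕ.+ suc s′) ⟩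
    0#                                      ≈⟨ A-3s+2 s′ ⟨
    A (suc (suc (s′ ℕ.* 3)))                ≡⟨ ≡.cong A b≡ ⟨
    A b                                     ∎
    where
    b≡ : b ≡ suc (suc (s′ ℕ.* 3))
    b≡ = ℕₚ.suc-injective (≡.trans 1+b≡N N≡3s)
    index : suc (suc (s′ ℕ.* 3)) ℕ.+ suc s′ ℕ.* 3 ≡ suc (suc ((s′ ℕ.+ suc s′) ℕ.* 3))
    index = ℕ-solve (s′ ∷ [])
  ... | s , inj₂ (inj₁ N≡3s+1) = begin
    0# + A (b ℕ.+ N)                        ≈⟨ +-identityˡ _ ⟩
    A (b ℕ.+ N)                             ≡⟨ ≡.cong A (≡.trans (≡.cong₂ ℕ._+_ b≡ N≡3s+1) index) ⟩
    A (suc (2 ℕ.* s ℕ.* 3))                 ≈⟨ A-even-3s+1 s ⟩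
    q^ e                                    ≈⟨ *-identityʳ _ ⟨
    -- The inserted unit is (-1)^s q^{s(3s+1)/2}, with doubled exponent sN. Its part q^s completes
    -- q^e to q^{2sN}; the rest is the value at b.
    q^ e * 1#                               ≈⟨ *-congˡ (trans (sym (*-congˡ (pow-+ q (pent s) s))) (sg-q^-half s (pent s ℕ.+ s) (≡.trans (pent-half₁ s) (≡.cong (s ℕ.*_) (≡.sym N≡3s+1))))) ⟨
    q^ e * (sg s * (q^ (pent s) * q^ s))    ≈⟨ solve 4 (λ e s p x → e :* (s :* (p :* x)) := s :* p :* (e :* x)) refl _ _ _ _ ⟩
    sg s * q^ (pent s) * (q^ e * q^ s)      ≈⟨ *-congˡ (trans (q^-*₂ e s ≡.refl) (q^-root _ (2 ℕ.* s) (≡.trans e+s (≡.cong (2 ℕ.* s ℕ.*_) (≡.sym N≡3s+1))))) ⟩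
    sg s * q^ (pent s) * 1#                 ≈⟨ *-identityʳ _ ⟩
    sg s * q^ (pent s)                      ≈⟨ A-3s s ⟨
    A (s ℕ.* 3)                             ≡⟨ ≡.cong A b≡ ⟨
    A b                                     ∎
    where
    e = 6 ℕ.* s ℕ.* s ℕ.+ s
    b≡ : b ≡ s ℕ.* 3
    b≡ = ℕₚ.suc-injective (≡.trans 1+b≡N N≡3s+1)
    index : s ℕ.* 3 ℕ.+ suc (s ℕ.* 3) ≡ suc (2 ℕ.* s ℕ.* 3)
    index = ℕ-solve (s ∷ [])
    e+s : 6 ℕ.* s ℕ.* s ℕ.+ s ℕ.+ s ≡ 2 ℕ.* s ℕ.* suc (s ℕ.* 3)
    e+s = ℕ-solve (s ∷ [])
  ... | s , inj₂ (inj₂ N≡3s+2) = begin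
    0# + A (b ℕ.+ N)                        ≈⟨ +-identityˡ _ ⟩
    A (b ℕ.+ N)                             ≡⟨ ≡.cong A (≡.trans (≡.cong₂ ℕ._+_ b≡ N≡3s+2) index) ⟩
    A (suc (2 ℕ.* s) ℕ.* 3)                 ≈⟨ A-odd-3s s ⟩
    - q^ e                                  ≈⟨ *-identityʳ _ ⟨
    -- The inserted unit has doubled exponent (s + 1)N. Its part q^{2s+1} completes e to (2s + 1)N,
    -- and its extra sign absorbs the minus.
    - q^ e * 1#                             ≈⟨ *-congˡ (sg-q^-half (suc s) (pent (suc s)) (≡.trans (pent-half₂ s) (≡.cong (suc s ℕ.*_) (≡.sym N≡3s+2)))) ⟨
    - q^ e * (sg (suc s) * q^ (pent (suc s))) ≈⟨ *-congˡ (*-congˡ (q^-*₂ (pent s ℕ.+ s) (suc (2 ℕ.* s)) (split (pent s)))) ⟨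
    - q^ e * (sg (suc s) * (q^ (pent s ℕ.+ s) * q^ (suc (2 ℕ.* s))))
      ≈⟨ solve 4 (λ e s p x → (:- e) :* (s :* (:- con (+ 1)) :* (p :* x)) := s :* p :* (e :* x)) refl _ _ _ _ ⟩
    sg s * q^ (pent s ℕ.+ s) * (q^ e * q^ (suc (2 ℕ.* s)))
      ≈⟨ *-congˡ (trans (q^-*₂ e (suc (2 ℕ.* s)) ≡.refl) (q^-root _ (suc (2 ℕ.* s)) (≡.trans e+2s+1 (≡.cong (suc (2 ℕ.* s) ℕ.*_) (≡.sym N≡3s+2))))) ⟩
    sg s * q^ (pent s ℕ.+ s) * 1#           ≈⟨ *-identityʳ _ ⟩
    sg s * q^ (pent s ℕ.+ s)                ≈⟨ A-3s+1 s ⟨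
    A (suc (s ℕ.* 3))                       ≡⟨ ≡.cong A b≡ ⟨
    A b                                     ∎
    where
    e = suc (2 ℕ.* s) ℕ.* suc (s ℕ.* 3)
    b≡ : b ≡ suc (s ℕ.* 3)
    b≡ = ℕₚ.suc-injective (≡.trans 1+b≡N N≡3s+2)
    index : suc (s ℕ.* 3) ℕ.+ suc (suc (s ℕ.* 3)) ≡ suc (2 ℕ.* s) ℕ.* 3
    index = ℕ-solve (s ∷ [])
    split : ∀ p → p ℕ.+ s ℕ.+ suc (2 ℕ.* s) ≡ p ℕ.+ suc (s ℕ.* 3)
    split p = ℕ-solve (p ∷ s ∷ [])
    e+2s+1 : suc (2 ℕ.* s) ℕ.* suc (s ℕ.* 3) ℕ.+ suc (2 ℕ.* s) ≡ suc (2 ℕ.* s) ℕ.* suc (suc (s ℕ.* 3))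
    e+2s+1 = ℕ-solve (s ∷ [])

  A-relation : ∀ a b → a ℕ.+ b ≡ suc N → A a + A (b ℕ.+ N) ≈ A b
  A-relation 0 b ≡.refl = A-base₀
  A-relation 1 b ≡.refl = A-base₁
  A-relation 2 b eq = A-base₂ b (ℕₚ.suc-injective eq)
  A-relation (suc (suc (suc a))) b eq = A-step a b (≡.trans (ℕₚ.+-suc (suc a) b) (ℕₚ.suc-injective eq))
    (A-relation a (suc (suc (suc b))) (≡.trans (shift a b) eq))
    where
    shift : ∀ a b → a ℕ.+ suc (suc (suc b)) ≡ suc (suc (suc a)) ℕ.+ b
    shift a b = ℕ-solve (a ∷ b ∷ [])

-- Columns, reflection and folding.

module Evaluation {c ℓ : Level} (R : CommutativeRing c ℓ)
  (domain : IsIntegralDomain R) (charZero : CharZero R)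
  (N : ℕ) (1≤N : 1 ≤ N) (q : CommutativeRing.Carrier R) (primRoot : IsPrimitiveRoot R N q) where
  open CommutativeRing R hiding (zero)
  open RingSolver R
  open Sums R
  open QSeries R q
  open BaileyPairs R q
  open BaileyChain R domain charZero N q primRoot
  open CiglerSums R q
  open AtRoot R domain charZero N 1≤N q primRoot
  open Relation.Binary.Reasoning.Setoid setoid

  -- The mirror index k + n contributes the values of `A` at n + N and n + 1 + N. They pair
  -- crosswise with those at 2k + 2 and 2k + 1: in each pair the unshifted indices sum to N + 1.
  alpha-pair : ∀ k n → N ≡ suc (2 ℕ.* k ℕ.+ n) →
    alpha R q k + alpha R q (k ℕ.+ n) ≈ A (suc n) + A n
  alpha-pair k n N≡ = begin
    alpha R q k + alpha R q (k ℕ.+ n)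
      ≈⟨ +-cong (alpha-A k) (alpha-A (k ℕ.+ n)) ⟩
    (A (suc (2 ℕ.* k)) + A (suc (suc (2 ℕ.* k)))) + (A (suc (2 ℕ.* (k ℕ.+ n))) + A (suc (suc (2 ℕ.* (k ℕ.+ n)))))
      ≡⟨ ≡.cong₂ (λ x y → (A (suc (2 ℕ.* k)) + A (suc (suc (2 ℕ.* k)))) + (A x + A y)) index₁ (≡.cong suc index₁) ⟩
    (A (suc (2 ℕ.* k)) + A (suc (suc (2 ℕ.* k)))) + (A (n ℕ.+ N) + A (suc n ℕ.+ N))
      ≈⟨ solve 4 (λ a b c d → (a :+ b) :+ (c :+ d) := (a :+ d) :+ (b :+ c)) refl _ _ _ _ ⟩
    (A (suc (2 ℕ.* k)) + A (suc n ℕ.+ N)) + (A (suc (suc (2 ℕ.* k))) + A (n ℕ.+ N))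
      ≈⟨ +-cong (A-relation (suc (2 ℕ.* k)) (suc n) (≡.cong suc (≡.trans (ℕₚ.+-suc (2 ℕ.* k) n) (≡.sym N≡))))
                (A-relation (suc (suc (2 ℕ.* k))) n (≡.cong suc (≡.sym N≡))) ⟩
    A (suc n) + A n ∎
    where
    index : suc (2 ℕ.* (k ℕ.+ n)) ≡ n ℕ.+ suc (2 ℕ.* k ℕ.+ n)
    index = ℕ-solve (k ∷ n ∷ [])
    index₁ : suc (2 ℕ.* (k ℕ.+ n)) ≡ n ℕ.+ N
    index₁ = ≡.trans index (≡.cong (n ℕ.+_) (≡.sym N≡))

  alpha-middle : ∀ k → N ≡ suc (2 ℕ.* k) → alpha R q k ≈ 1#
  alpha-middle k N≡ = begin
    alpha R q k                                     ≈⟨ alpha-A k ⟩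
    A (suc (2 ℕ.* k)) + A (suc (suc (2 ℕ.* k)))     ≡⟨ ≡.cong (λ n → A (suc (2 ℕ.* k)) + A (suc n)) N≡ ⟨
    A (suc (2 ℕ.* k)) + A (1 ℕ.+ N)                 ≈⟨ A-relation (suc (2 ℕ.* k)) 1 (≡.trans (ℕₚ.+-comm (suc (2 ℕ.* k)) 1) (≡.cong suc (≡.sym N≡))) ⟩
    1#                                              ∎

  -- From q^N = 1 comes 1 - q^{N-j} = -q^(-j) (1 - q^j). For j from M + 1 to M + d this maps the
  -- numerator of [N-1-M, d] to that of [M+d, d], and these j add up to Md + d(d+1)/2.
  reflect : ∀ d s M → s ℕ.+ suc M ≡ N → d ≤ s → q^ (M ℕ.* d ℕ.+ tri (suc d)) * binom s d ≈ sg d * binom (M ℕ.+ d) d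
  reflect zero s M _ _ = *-congʳ (q^-≡ (≡.trans (ℕₚ.+-identityʳ _) (ℕₚ.*-zeroʳ M)))
  reflect (suc d) s M s+1+M≡N d<s = *-cancelʳ (1-q^-nonzero (suc d) z<s d<N) (begin
    q^ (M ℕ.* suc d ℕ.+ tri (suc (suc d))) * binom s (suc d) * (1# - q^ (suc d))
      ≈⟨ *-assoc _ _ _ ⟩
    q^ (M ℕ.* suc d ℕ.+ tri (suc (suc d))) * (binom s (suc d) * (1# - q^ (suc d)))
      ≈⟨ *-cong q^-split (binom-absorb s d) ⟩
    X * Y * (binom s d * (1# - q^ (s ∸ d)))
      ≈⟨ solve 4 (λ x y b z → x :* y :* (b :* (con (+ 1) :- z)) := (x :* b) :* (y :- y :* z)) refl _ _ _ _ ⟩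
    X * binom s d * (Y - Y * q^ (s ∸ d))
      ≈⟨ *-cong (reflect d s M s+1+M≡N (ℕₚ.<⇒≤ d<s)) (+-congˡ (-‿cong (trans (q^-*₂ (M ℕ.+ suc d) (s ∸ d) index) q^N≈1))) ⟩
    sg d * B * (Y - 1#)
      ≈⟨ solve 3 (λ s b y → s :* b :* (y :- con (+ 1)) := s :* (:- con (+ 1)) :* (b :* (con (+ 1) :- y))) refl _ _ _ ⟩
    sg (suc d) * (B * (1# - q^ (M ℕ.+ suc d)))
      ≡⟨ ≡.cong (λ m → sg (suc d) * (B * (1# - q^ m))) (ℕₚ.+-suc M d) ⟩
    sg (suc d) * (B * (1# - q^ (suc (M ℕ.+ d))))
      ≈⟨ *-congˡ (binom-absorb′ (M ℕ.+ d) d) ⟨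
    sg (suc d) * (binom (suc (M ℕ.+ d)) (suc d) * (1# - q^ (suc d)))
      ≡⟨ ≡.cong (λ m → sg (suc d) * (binom m (suc d) * (1# - q^ (suc d)))) (ℕₚ.+-suc M d) ⟨
    sg (suc d) * (binom (M ℕ.+ suc d) (suc d) * (1# - q^ (suc d)))
      ≈⟨ *-assoc _ _ _ ⟨
    sg (suc d) * binom (M ℕ.+ suc d) (suc d) * (1# - q^ (suc d)) ∎)
    where
    X = q^ (M ℕ.* d ℕ.+ tri (suc d))
    Y = q^ (M ℕ.+ suc d)
    B = binom (M ℕ.+ d) d
    d<N : suc d < N
    d<N = ℕₚ.<-≤-trans (s≤s d<s) (≡.subst (suc s ≤_) (≡.trans (≡.sym (ℕₚ.+-suc s M)) s+1+M≡N) (s≤s (ℕₚ.m≤m+n s M)))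
    q^-split : q^ (M ℕ.* suc d ℕ.+ tri (suc (suc d))) ≈ X * Y
    q^-split = sym (q^-*₂ (M ℕ.* d ℕ.+ tri (suc d)) (M ℕ.+ suc d) (split (tri (suc d))))
      where
      split : ∀ t → M ℕ.* d ℕ.+ t ℕ.+ (M ℕ.+ suc d) ≡ M ℕ.* suc d ℕ.+ (t ℕ.+ suc d)
      split t = ℕ-solve (t ∷ M ∷ d ∷ [])
    index : M ℕ.+ suc d ℕ.+ (s ∸ d) ≡ N
    index = ≡.trans (regroup (s ∸ d)) (≡.trans (≡.cong (ℕ._+ suc M) (ℕₚ.m+[n∸m]≡n (ℕₚ.<⇒≤ d<s))) s+1+M≡N)
      where
      regroup : ∀ e → M ℕ.+ suc d ℕ.+ e ≡ d ℕ.+ e ℕ.+ suc M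
      regroup e = ℕ-solve (e ∷ M ∷ d ∷ [])

  q⁻¹ : Carrier
  q⁻¹ = q^ (N ∸ 1)

  q*q⁻¹ : q * q⁻¹ ≈ 1#
  q*q⁻¹ = trans (*-comm _ _) (trans (q^-≡ (ℕₚ.m+[n∸m]≡n 1≤N)) q^N≈1)

  q^⁻ : ℕ → Carrier
  q^⁻ = pow R q⁻¹

  q^-inverse : ∀ n → q^ n * q^⁻ n ≈ 1#
  q^-inverse zero    = *-identityʳ 1#
  q^-inverse (suc n) = begin
    q^ n * q * (q^⁻ n * q⁻¹)      ≈⟨ solve 4 (λ a b x y → a :* x :* (b :* y) := a :* b :* (x :* y)) refl _ _ _ _ ⟩
    q^ n * q^⁻ n * (q * q⁻¹)      ≈⟨ *-cong (q^-inverse n) q*q⁻¹ ⟩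
    1# * 1#                       ≈⟨ *-identityʳ 1# ⟩
    1#                            ∎

  -- The power of q with exponent k^2 - (k+d)^2: the negative part is the factor of H at n = k + d,
  -- and q^{k^2} is borrowed from the chain weight.
  scale : ℕ → ℕ → Carrier
  scale k d = q^ (k ℕ.* k) * q^⁻ ((k ℕ.+ d) ℕ.* (k ℕ.+ d))

  eTerm : ℕ → ℕ → Carrier
  eTerm k d = scale k d * binom (2 ℕ.* (k ℕ.+ d)) d

  -- With M = n - 2d one has d(d+1) + Md + (k+d)^2 = k^2 + dN. Half of d(d+1) goes with Md into
  -- `reflect`; the other half is the exponent of `gTerm`.
  eTerm-reflect : ∀ k d n → N ≡ suc (2 ℕ.* k ℕ.+ n) → d ℕ.+ d ≤ n → eTerm k d ≈ gTerm n d
  eTerm-reflect k d n N≡ 2d≤n = begin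
    q^ (k ℕ.* k) * q^⁻ K * B             ≈⟨ *-congʳ (*-congʳ (sym (q^-shift (k ℕ.* k) d index))) ⟩
    q^ (T ℕ.+ (M ℕ.* d ℕ.+ T) ℕ.+ K) * q^⁻ K * B
      ≈⟨ *-congʳ (*-congʳ (sym (q^-*₃ T (M ℕ.* d ℕ.+ T) K ≡.refl))) ⟩
    q^ T * Y * q^ K * q^⁻ K * B          ≈⟨ solve 5 (λ t y x z b → t :* y :* x :* z :* b := t :* (y :* b) :* (x :* z)) refl _ _ _ _ _ ⟩
    q^ T * (Y * B) * (q^ K * q^⁻ K)      ≈⟨ *-cong (*-congˡ (reflect d (2 ℕ.* (k ℕ.+ d)) M s+1+M≡N d≤s)) (q^-inverse K) ⟩
    q^ T * (sg d * binom (M ℕ.+ d) d) * 1# ≈⟨ solve 3 (λ t s b → t :* (s :* b) :* con (+ 1) := s :* t :* b) refl _ _ _ ⟩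
    sg d * q^ T * binom (M ℕ.+ d) d      ≡⟨ ≡.cong (λ m → sg d * q^ T * binom m d) M+d≡n∸d ⟩
    gTerm n d                            ∎
    where
    K = (k ℕ.+ d) ℕ.* (k ℕ.+ d)
    T = tri (suc d)
    M = n ∸ (d ℕ.+ d)
    B = binom (2 ℕ.* (k ℕ.+ d)) d
    Y = q^ (M ℕ.* d ℕ.+ T)
    d≤s : d ≤ 2 ℕ.* (k ℕ.+ d)
    d≤s = ℕₚ.≤-trans (ℕₚ.m≤n+m d k) (m≤2*m (k ℕ.+ d))
    2d+M≡n : d ℕ.+ d ℕ.+ M ≡ n
    2d+M≡n = ℕₚ.m+[n∸m]≡n 2d≤n
    M+d≡n∸d : M ℕ.+ d ≡ n ∸ d
    M+d≡n∸d = ≡.trans (≡.sym (ℕₚ.m+n∸m≡n d (M ℕ.+ d))) (≡.cong (_∸ d) (≡.trans (regroup M) 2d+M≡n))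
      where
      regroup : ∀ m → d ℕ.+ (m ℕ.+ d) ≡ d ℕ.+ d ℕ.+ m
      regroup m = ℕ-solve (m ∷ d ∷ [])
    s+1+M≡N : 2 ℕ.* (k ℕ.+ d) ℕ.+ suc M ≡ N
    s+1+M≡N = ≡.trans (regroup M) (≡.trans (≡.cong (λ m → suc (2 ℕ.* k ℕ.+ m)) 2d+M≡n) (≡.sym N≡))
      where
      regroup : ∀ m → 2 ℕ.* (k ℕ.+ d) ℕ.+ suc m ≡ suc (2 ℕ.* k ℕ.+ (d ℕ.+ d ℕ.+ m))
      regroup m = ℕ-solve (m ∷ k ∷ d ∷ [])
    index : T ℕ.+ (M ℕ.* d ℕ.+ T) ℕ.+ K ≡ k ℕ.* k ℕ.+ d ℕ.* N
    index = ≡.trans (regroup₁ T M) (≡.trans (≡.cong (λ t → t ℕ.+ (M ℕ.* d ℕ.+ K)) (tri-double d))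
      (≡.trans (regroup₂ M) (≡.cong (λ m → k ℕ.* k ℕ.+ d ℕ.* m) s+1+M≡N)))
      where
      regroup₁ : ∀ t m → t ℕ.+ (m ℕ.* d ℕ.+ t) ℕ.+ (k ℕ.+ d) ℕ.* (k ℕ.+ d) ≡ 2 ℕ.* t ℕ.+ (m ℕ.* d ℕ.+ (k ℕ.+ d) ℕ.* (k ℕ.+ d))
      regroup₁ t m = ℕ-solve (t ∷ m ∷ k ∷ d ∷ [])
      regroup₂ : ∀ m → d ℕ.* d ℕ.+ d ℕ.+ (m ℕ.* d ℕ.+ (k ℕ.+ d) ℕ.* (k ℕ.+ d)) ≡ k ℕ.* k ℕ.+ d ℕ.* (2 ℕ.* (k ℕ.+ d) ℕ.+ suc m)
      regroup₂ m = ℕ-solve (m ∷ k ∷ d ∷ [])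

  -- The bounds fix L as the integer part of n/2, plus one: the upper bound keeps 2d ≤ n, as the
  -- reflection requires, and the lower one covers the support of `gTerm n`.
  sum-eTerm : ∀ k n L → N ≡ suc (2 ℕ.* k ℕ.+ n) → n < L ℕ.+ L → L ℕ.+ L ≤ suc (suc n) → sum L (eTerm k) ≈ G n
  sum-eTerm k n L N≡ n<2L 2L≤2+n = trans
    (sum-cong L (λ d d<L → eTerm-reflect k d n N≡ (s≤s⁻¹ (s≤s⁻¹ (ℕₚ.≤-trans
      (ℕₚ.≤-reflexive (≡.cong suc (≡.sym (ℕₚ.+-suc d d)))) (ℕₚ.≤-trans (ℕₚ.+-mono-≤ d<L d<L) 2L≤2+n))))))
    (sum-gTerm n L n<2L)

  column : ℕ → ℕ → Carrier
  column k L = sum L (λ d → scale k d * D k d)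

  -- Because q^{k^2} q^{2k+1} = q^{(k+1)^2} and k + d = (k + 1) + (d - 1), the subtracted half of D
  -- is `eTerm (suc k)` with d lowered by one; its term at d = 0 is zero.
  column-telescopes : ∀ k L → column k (suc L) ≈ sum (suc L) (eTerm k) - sum L (eTerm (suc k))
  column-telescopes k L = begin
    sum (suc L) (λ d → scale k d * D k d)
      ≈⟨ sum-cong (suc L) (λ d _ → solve 3 (λ s b c → s :* (b :- c) := s :* b :- s :* c) refl _ _ _) ⟩
    sum (suc L) (λ d → eTerm k d - lower d)
      ≈⟨ sum-- (suc L) (eTerm k) lower ⟩
    sum (suc L) (eTerm k) - sum (suc L) lower
      ≈⟨ +-congˡ (-‿cong (trans (sum-head L lower) (trans (+-cong lower-0 (sum-cong L (λ d _ → lower-suc d))) (+-identityˡ _)))) ⟩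
    sum (suc L) (eTerm k) - sum L (eTerm (suc k)) ∎
    where
    lower : ℕ → Carrier
    lower d = scale k d * (q^ (suc (2 ℕ.* k)) * binomPred (2 ℕ.* (k ℕ.+ d)) d)
    lower-0 : lower 0 ≈ 0#
    lower-0 = trans (*-congˡ (zeroʳ _)) (zeroʳ _)
    lower-suc : ∀ d → lower (suc d) ≈ eTerm (suc k) d
    lower-suc d = begin
      scale k (suc d) * (q^ (suc (2 ℕ.* k)) * binom (2 ℕ.* (k ℕ.+ suc d)) d)
        ≡⟨ ≡.cong (λ m → q^ (k ℕ.* k) * q^⁻ (m ℕ.* m) * (q^ (suc (2 ℕ.* k)) * binom (2 ℕ.* m) d)) (ℕₚ.+-suc k d) ⟩
      q^ (k ℕ.* k) * Z * (q^ (suc (2 ℕ.* k)) * B)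
        ≈⟨ solve 4 (λ x z y b → x :* z :* (y :* b) := x :* y :* z :* b) refl _ _ _ _ ⟩
      q^ (k ℕ.* k) * q^ (suc (2 ℕ.* k)) * Z * B
        ≈⟨ *-congʳ (*-congʳ (q^-*₂ (k ℕ.* k) (suc (2 ℕ.* k)) index)) ⟩
      q^ (suc k ℕ.* suc k) * Z * B ∎
      where
      Z = q^⁻ ((suc k ℕ.+ d) ℕ.* (suc k ℕ.+ d))
      B = binom (2 ℕ.* (suc k ℕ.+ d)) d
      index : k ℕ.* k ℕ.+ suc (2 ℕ.* k) ≡ suc k ℕ.* suc k
      index = ℕ-solve (k ∷ [])

  column-middle : ∀ k → N ≡ suc (2 ℕ.* k) → column k 1 ≈ alpha R q k
  column-middle k N≡ = begin
    column k 1                   ≈⟨ column-telescopes k 0 ⟩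
    sum 1 (eTerm k) - 0#         ≈⟨ solve 1 (λ x → x :- con (+ 0) := x) refl _ ⟩
    sum 1 (eTerm k)              ≈⟨ sum-eTerm k 0 1 (≡.trans N≡ (≡.cong suc (≡.sym (ℕₚ.+-identityʳ (2 ℕ.* k))))) z<s ℕₚ.≤-refl ⟩
    G 0                          ≈⟨ G-0 ⟩
    1#                           ≈⟨ alpha-middle k N≡ ⟨
    alpha R q k                  ∎

  -- Raising k by one lowers N - 1 - 2k by two, so the column is a sum of two consecutive
  -- differences of G, hence of two values of `A`: those found in `alpha-pair`.
  column-pair : ∀ k L n → N ≡ suc (2 ℕ.* k ℕ.+ suc n) → suc n < suc L ℕ.+ suc L → suc L ℕ.+ suc L ≤ suc (suc (suc n)) →
    column k (suc L) ≈ alpha R q k + alpha R q (k ℕ.+ suc n)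
  column-pair k L n N≡ lower upper = begin
    column k (suc L)                                     ≈⟨ column-telescopes k L ⟩
    sum (suc L) (eTerm k) - sum L (eTerm (suc k))        ≈⟨ +-congʳ (sum-eTerm k (suc n) (suc L) N≡ lower upper) ⟩
    G (suc n) - sum L (eTerm (suc k))                    ≈⟨ rest n L N≡ lower upper ⟩
    A (suc (suc n)) + A (suc n)                          ≈⟨ alpha-pair k (suc n) N≡ ⟨
    alpha R q k + alpha R q (k ℕ.+ suc n)                ∎
    where
    rest : ∀ n L → N ≡ suc (2 ℕ.* k ℕ.+ suc n) → suc n < suc L ℕ.+ suc L → suc L ℕ.+ suc L ≤ suc (suc (suc n)) →
      G (suc n) - sum L (eTerm (suc k)) ≈ A (suc (suc n)) + A (suc n)
    -- Here N = 2k + 2, so k is the last column and the subtracted sum is empty; A 2 = 0 and A 1 = 1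
    -- agree with G 1.
    rest zero zero N≡ lower upper = trans (+-congʳ G-1) (solve 0 (con (+ 1) :- con (+ 0) := con (+ 0) :+ con (+ 1)) refl)
    rest zero (suc L) N≡ lower upper = ⊥-elim (ℕₚ.<⇒≱ (s≤s (s≤s (ℕₚ.≤-trans (s≤s (s≤s z≤n)) (ℕₚ.m≤n+m (suc (suc L)) L)))) upper)
    rest (suc n) L N≡ lower upper = begin
      G (suc (suc n)) - sum L (eTerm (suc k))
        ≈⟨ +-congˡ (-‿cong (sum-eTerm (suc k) n L (≡.trans N≡ (≡.cong suc index)) (shrink lower) (shrink′ upper))) ⟩
      G (suc (suc n)) - G n
        ≈⟨ solve 3 (λ x y z → x :- z := (x :- y) :+ (y :- z)) refl _ (G (suc n)) _ ⟩
      (G (suc (suc n)) - G (suc n)) + (G (suc n) - G n)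
        ≈⟨ +-cong (G-suc (suc n)) (G-suc n) ⟩
      A (suc (suc (suc n))) + A (suc (suc n)) ∎
      where
      index : 2 ℕ.* k ℕ.+ suc (suc n) ≡ 2 ℕ.* suc k ℕ.+ n
      index = ℕ-solve (k ∷ n ∷ [])
      shrink : suc (suc n) < suc L ℕ.+ suc L → n < L ℕ.+ L
      shrink lt = s≤s⁻¹ (s≤s⁻¹ (≡.subst (suc (suc n) <_) (≡.cong suc (ℕₚ.+-suc L L)) lt))
      shrink′ : suc L ℕ.+ suc L ≤ suc (suc (suc (suc n))) → L ℕ.+ L ≤ suc (suc n)
      shrink′ le = s≤s⁻¹ (s≤s⁻¹ (≡.subst (_≤ suc (suc (suc (suc n)))) (≡.cong suc (ℕₚ.+-suc L L)) le))

  weight : ℕ → ℕ → Carrier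
  weight i k = sg k * q^ (tri (suc k) ℕ.+ i ℕ.* (k ℕ.* k ℕ.+ k))

  -- Passing from k to k + n raises k^2 + k by nN and the triangular exponent by nN/2. The latter is
  -- compensated by the sign (-1)^n.
  weight-symmetric : ∀ i k n → N ≡ suc (2 ℕ.* k ℕ.+ n) → weight i (k ℕ.+ n) ≈ weight i k
  weight-symmetric i k n N≡ = begin
    sg (k ℕ.+ n) * q^ (tri (suc (k ℕ.+ n)) ℕ.+ i ℕ.* ((k ℕ.+ n) ℕ.* (k ℕ.+ n) ℕ.+ (k ℕ.+ n)))
      ≈⟨ *-cong (pow-+ (- 1#) k n) (trans (q^-shift _ (i ℕ.* n) index) (pow-+ q (tri (suc k) ℕ.+ i ℕ.* (k ℕ.* k ℕ.+ k)) e)) ⟩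
    sg k * sg n * (q^ (tri (suc k) ℕ.+ i ℕ.* (k ℕ.* k ℕ.+ k)) * q^ e)
      ≈⟨ solve 4 (λ a b x y → a :* b :* (x :* y) := a :* x :* (b :* y)) refl _ _ _ _ ⟩
    weight i k * (sg n * q^ e)
      ≈⟨ trans (*-congˡ (sg-q^-half n e half)) (*-identityʳ _) ⟩
    weight i k ∎
    where
    e = k ℕ.* n ℕ.+ tri (suc n)
    half : 2 ℕ.* e ≡ n ℕ.* N
    half = ≡.trans (ℕₚ.*-distribˡ-+ 2 (k ℕ.* n) (tri (suc n)))
      (≡.trans (≡.cong (2 ℕ.* (k ℕ.* n) ℕ.+_) (tri-double n)) (≡.trans regroup (≡.cong (n ℕ.*_) (≡.sym N≡))))
      where
      regroup : 2 ℕ.* (k ℕ.* n) ℕ.+ (n ℕ.* n ℕ.+ n) ≡ n ℕ.* suc (2 ℕ.* k ℕ.+ n)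
      regroup = ℕ-solve (k ∷ n ∷ [])
    index : tri (suc (k ℕ.+ n)) ℕ.+ i ℕ.* ((k ℕ.+ n) ℕ.* (k ℕ.+ n) ℕ.+ (k ℕ.+ n)) ≡
      (tri (suc k) ℕ.+ i ℕ.* (k ℕ.* k ℕ.+ k) ℕ.+ e) ℕ.+ i ℕ.* n ℕ.* N
    index = ≡.trans (≡.cong (ℕ._+ i ℕ.* ((k ℕ.+ n) ℕ.* (k ℕ.+ n) ℕ.+ (k ℕ.+ n))) (tri-+ k n))
      (≡.trans (regroup (tri (suc k)) e) (≡.cong (λ m → tri (suc k) ℕ.+ i ℕ.* (k ℕ.* k ℕ.+ k) ℕ.+ e ℕ.+ i ℕ.* n ℕ.* m) (≡.sym N≡)))
      where
      regroup : ∀ t e → t ℕ.+ e ℕ.+ i ℕ.* ((k ℕ.+ n) ℕ.* (k ℕ.+ n) ℕ.+ (k ℕ.+ n)) ≡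
        t ℕ.+ i ℕ.* (k ℕ.* k ℕ.+ k) ℕ.+ e ℕ.+ i ℕ.* n ℕ.* suc (2 ℕ.* k ℕ.+ n)
      regroup t e = ℕ-solve (t ∷ e ∷ i ∷ k ∷ n ∷ [])

  -- Some exponent among n + 1, ..., 2n is a multiple of N: N itself if n < N, and otherwise the
  -- first multiple beyond n, which lies within distance N ≤ n.
  P-root : ∀ n → N ≤ 2 ℕ.* n → P (suc n) n ≈ 0#
  P-root n N≤2n with N ℕ.≤? n
  ... | yes N≤n = P-vanish (suc n) n (N ∸ suc (n ℕ.% N))
        (ℕₚ.<-≤-trans (ℕₚ.∸-monoʳ-< z<s (ℕ÷.m%n<n n N)) N≤n)
        (q^-root _ (suc (n ℕ./ N)) index)
    where
    instance
      N≢0 : ℕ.NonZero N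
      N≢0 = ℕ.>-nonZero 1≤N
    regroup : ∀ r m u → suc (r ℕ.+ m) ℕ.+ u ≡ suc r ℕ.+ u ℕ.+ m
    regroup r m u = ℕ-solve (r ∷ m ∷ u ∷ [])
    index : suc n ℕ.+ (N ∸ suc (n ℕ.% N)) ≡ suc (n ℕ./ N) ℕ.* N
    index = ≡.trans (≡.cong (λ m → suc m ℕ.+ (N ∸ suc (n ℕ.% N))) (ℕ÷.m≡m%n+[m/n]*n n N))
      (≡.trans (regroup (n ℕ.% N) (n ℕ./ N ℕ.* N) (N ∸ suc (n ℕ.% N)))
        (≡.cong (ℕ._+ n ℕ./ N ℕ.* N) (ℕₚ.m+[n∸m]≡n (ℕ÷.m%n<n n N))))
  ... | no N≰n = P-vanish (suc n) n (N ∸ suc n)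
        (≡.subst (N ∸ suc n <_) (ℕₚ.m+n∸n≡m n n) bound)
        (trans (q^-≡ (ℕₚ.m+[n∸m]≡n n<N)) q^N≈1)
    where
    n<N : n < N
    n<N = ℕₚ.≰⇒> N≰n
    bound : N ∸ suc n < n ℕ.+ n ∸ n
    bound = ℕₚ.<-≤-trans (ℕₚ.∸-monoʳ-< (ℕₚ.n<1+n n) n<N)
      (ℕₚ.∸-monoˡ-≤ n (ℕₚ.≤-trans N≤2n (ℕₚ.≤-reflexive (≡.cong (n ℕ.+_) (ℕₚ.+-identityʳ n)))))

  -- The conditions make h the number of n with 2n < N. All later terms vanish by `P-root`, so the
  -- truncation point M has no influence on the value.
  Htrunc-columns : ∀ i M h → N ≤ M → h ≤ N → N ≤ 2 ℕ.* h → (∀ n → n < h → 2 ℕ.* n < N) →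
    Htrunc R q q⁻¹ (suc i) M ≈ sum h (λ k → weight i k * column k (h ∸ k))
  Htrunc-columns i M h N≤M h≤N N≤2h below = begin
    sum M t
      ≈⟨ sum-extend t (ℕₚ.≤-trans h≤N N≤M) (λ n h≤n → vanish n (ℕₚ.≤-trans N≤2h (ℕₚ.*-monoʳ-≤ 2 h≤n))) ⟩
    sum h t
      ≈⟨ sum-cong h (λ n n<h → expand n (below n n<h)) ⟩
    sum h (λ n → sum (suc n) (λ k → F k (n ∸ k)))
      ≈⟨ sum-triangle h F ⟩
    sum h (λ k → sum (h ∸ k) (F k))
      ≈⟨ sum-cong h (λ k _ → *-sum (h ∸ k) (weight i k) _) ⟨
    sum h (λ k → weight i k * column k (h ∸ k)) ∎
    where
    t : ℕ → Carrier
    t n = q^⁻ (n ℕ.* n) * P (suc n) n * inner R q i n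

    F : ℕ → ℕ → Carrier
    F k d = weight i k * (scale k d * D k d)

    vanish : ∀ n → N ≤ 2 ℕ.* n → t n ≈ 0#
    vanish n N≤2n = trans (*-congʳ (trans (*-congˡ (P-root n N≤2n)) (zeroʳ _))) (zeroˡ _)

    -- One of the i + 1 factors q^{k^2+k} is spent here: q^k turns `tri k` into `tri (suc k)`, and
    -- q^{k^2} passes to `scale`.
    chainWeight-weight : ∀ k → chainWeight (suc i) k ≈ weight i k * q^ (k ℕ.* k)
    chainWeight-weight k = trans (*-congˡ (sym (q^-*₂ (tri (suc k) ℕ.+ i ℕ.* (k ℕ.* k ℕ.+ k)) (k ℕ.* k) (regroup (tri k) (k ℕ.* k) (i ℕ.* (k ℕ.* k ℕ.+ k)))))) (sym (*-assoc _ _ _))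
      where
      regroup : ∀ t s u → t ℕ.+ k ℕ.+ u ℕ.+ s ≡ t ℕ.+ (s ℕ.+ k ℕ.+ u)
      regroup t s u = ℕ-solve (t ∷ s ∷ u ∷ k ∷ [])

    expand : ∀ n → 2 ℕ.* n < N → t n ≈ sum (suc n) (λ k → F k (n ∸ k))
    expand n 2n<N = begin
      q^⁻ (n ℕ.* n) * P (suc n) n * inner R q i n
        ≈⟨ *-assoc _ _ _ ⟩
      q^⁻ (n ℕ.* n) * (P (suc n) n * inner R q i n)
        ≈⟨ *-congˡ (inner-pair i n 2n<N) ⟩
      q^⁻ (n ℕ.* n) * sum (suc n) (λ k → chainWeight (suc i) k * D k (n ∸ k))
        ≈⟨ *-sum (suc n) _ _ ⟩
      sum (suc n) (λ k → q^⁻ (n ℕ.* n) * (chainWeight (suc i) k * D k (n ∸ k)))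
        ≈⟨ sum-cong (suc n) (λ k k<1+n → term k (s≤s⁻¹ k<1+n)) ⟩
      sum (suc n) (λ k → F k (n ∸ k)) ∎
      where
      term : ∀ k → k ≤ n → q^⁻ (n ℕ.* n) * (chainWeight (suc i) k * D k (n ∸ k)) ≈ F k (n ∸ k)
      term k k≤n = begin
        q^⁻ (n ℕ.* n) * (chainWeight (suc i) k * D k (n ∸ k))
          ≈⟨ *-congˡ (*-congʳ (chainWeight-weight k)) ⟩
        q^⁻ (n ℕ.* n) * (weight i k * q^ (k ℕ.* k) * D k (n ∸ k))
          ≈⟨ solve 4 (λ z w x d → z :* (w :* x :* d) := w :* (x :* z :* d)) refl _ _ _ _ ⟩
        weight i k * (q^ (k ℕ.* k) * q^⁻ (n ℕ.* n) * D k (n ∸ k))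
          ≡⟨ ≡.cong (λ m → weight i k * (q^ (k ℕ.* k) * q^⁻ (m ℕ.* m) * D k (n ∸ k))) (ℕₚ.m+[n∸m]≡n k≤n) ⟨
        F k (n ∸ k) ∎

  rhs-weight : ∀ i → rhs R q (suc i) N ≈ sum N (λ k → weight i k * alpha R q k)
  rhs-weight i = sum-cong N (λ k _ → *-congʳ (*-congˡ (q^-≡ (≡.cong (ℕ._+ i ℕ.* (k ℕ.* k ℕ.+ k)) (tri-/2 k)))))

  fold-pair : ∀ i k L n → N ≡ suc (2 ℕ.* k ℕ.+ suc n) → suc n < suc L ℕ.+ suc L → suc L ℕ.+ suc L ≤ suc (suc (suc n)) →
    weight i k * column k (suc L) ≈ weight i k * alpha R q k + weight i (k ℕ.+ suc n) * alpha R q (k ℕ.+ suc n)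
  fold-pair i k L n N≡ lower upper = begin
    weight i k * column k (suc L)
      ≈⟨ *-congˡ (column-pair k L n N≡ lower upper) ⟩
    weight i k * (alpha R q k + alpha R q (k ℕ.+ suc n))
      ≈⟨ distribˡ _ _ _ ⟩
    weight i k * alpha R q k + weight i k * alpha R q (k ℕ.+ suc n)
      ≈⟨ +-congˡ (*-congʳ (weight-symmetric i k (suc n) N≡)) ⟨
    weight i k * alpha R q k + weight i (k ℕ.+ suc n) * alpha R q (k ℕ.+ suc n) ∎

  sum-fold : ∀ h m (f : ℕ → Carrier) → sum (h ℕ.+ m) f ≈ sum h f + sum m (λ k → f (h ℕ.+ (m ∸ suc k)))
  sum-fold h m f = trans (sum-split h m f) (+-congˡ (sum-reverse m _))

  evaluation : ∀ i M → N ≤ M → Htrunc R q q⁻¹ (suc i) M ≈ rhs R q (suc i) N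
  evaluation i M N≤M with parity N
  ... | inj₁ (h , N≡2h) = begin
    Htrunc R q q⁻¹ (suc i) M
      ≈⟨ Htrunc-columns i M h N≤M (≡.subst (h ≤_) (≡.sym N≡2h) (m≤2*m h)) (ℕₚ.≤-reflexive N≡2h)
           (λ n n<h → ≡.subst (2 ℕ.* n <_) (≡.sym N≡2h) (ℕₚ.*-monoʳ-< 2 n<h)) ⟩
    sum h (λ k → weight i k * column k (h ∸ k))
      ≈⟨ sum-cong h (λ k k<h → term k (ℕₚ.m≤n⇒∃[o]m+o≡n k<h)) ⟩
    sum h (λ k → X k + X (h ℕ.+ (h ∸ suc k)))
      ≈⟨ sum-+ h _ _ ⟩
    sum h X + sum h (λ k → X (h ℕ.+ (h ∸ suc k)))
      ≈⟨ sum-fold h h X ⟨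
    sum (h ℕ.+ h) X
      ≡⟨ ≡.cong (λ n → sum n X) (≡.trans N≡2h (≡.cong (h ℕ.+_) (ℕₚ.+-identityʳ h))) ⟨
    sum N X
      ≈⟨ rhs-weight i ⟨
    rhs R q (suc i) N ∎
    where
    X : ℕ → Carrier
    X k = weight i k * alpha R q k
    term : ∀ k → (∃ λ o → suc k ℕ.+ o ≡ h) → weight i k * column k (h ∸ k) ≈ X k + X (h ℕ.+ (h ∸ suc k))
    term k (L , ≡.refl) = begin
      weight i k * column k (suc k ℕ.+ L ∸ k)          ≡⟨ ≡.cong (λ l → weight i k * column k l) index₁ ⟩
      weight i k * column k (suc L)                    ≈⟨ fold-pair i k L (L ℕ.+ L) (≡.trans N≡2h index₂) lower upper ⟩
      X k + X (k ℕ.+ suc (L ℕ.+ L))                    ≡⟨ ≡.cong (λ l → X k + X l) index₃ ⟩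
      X k + X (suc k ℕ.+ L ℕ.+ L)                      ≡⟨ ≡.cong (λ l → X k + X (suc k ℕ.+ L ℕ.+ l)) (ℕₚ.m+n∸m≡n (suc k) L) ⟨
      X k + X (suc k ℕ.+ L ℕ.+ (suc k ℕ.+ L ∸ suc k))  ∎
      where
      index₁ : suc k ℕ.+ L ∸ k ≡ suc L
      index₁ = ≡.trans (≡.cong (_∸ k) (≡.sym (ℕₚ.+-suc k L))) (ℕₚ.m+n∸m≡n k (suc L))
      index₂ : 2 ℕ.* (suc k ℕ.+ L) ≡ suc (2 ℕ.* k ℕ.+ suc (L ℕ.+ L))
      index₂ = ℕ-solve (k ∷ L ∷ [])
      index₃ : k ℕ.+ suc (L ℕ.+ L) ≡ suc k ℕ.+ L ℕ.+ L
      index₃ = ℕ-solve (k ∷ L ∷ [])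
      lower : suc (L ℕ.+ L) < suc L ℕ.+ suc L
      lower = ℕₚ.≤-reflexive (≡.cong suc (≡.sym (ℕₚ.+-suc L L)))
      upper : suc L ℕ.+ suc L ≤ suc (suc (suc (L ℕ.+ L)))
      upper = ℕₚ.≤-trans (ℕₚ.≤-reflexive (≡.cong suc (ℕₚ.+-suc L L))) (ℕₚ.n≤1+n _)
  -- For odd N the index h is its own mirror image: its column consists of the entry d = 0 alone and
  -- matches the single unpaired summand.
  ... | inj₂ (h , N≡1+2h) = begin
    Htrunc R q q⁻¹ (suc i) M
      ≈⟨ Htrunc-columns i M (suc h) N≤M (≡.subst (suc h ≤_) (≡.sym N≡1+2h) (s≤s (m≤2*m h)))
           (≡.subst (_≤ 2 ℕ.* suc h) (≡.sym N≡1+2h) (ℕₚ.≤-trans (ℕₚ.n≤1+n _) (ℕₚ.≤-reflexive double)))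
           (λ n n<1+h → ≡.subst (2 ℕ.* n <_) (≡.sym N≡1+2h) (s≤s (ℕₚ.*-monoʳ-≤ 2 (s≤s⁻¹ n<1+h)))) ⟩
    sum h (λ k → weight i k * column k (suc h ∸ k)) + weight i h * column h (suc h ∸ h)
      ≈⟨ +-cong (sum-cong h (λ k k<h → term k (ℕₚ.m≤n⇒∃[o]m+o≡n k<h))) (*-congˡ middle) ⟩
    sum h (λ k → X k + X (suc h ℕ.+ (h ∸ suc k))) + X h
      ≈⟨ +-congʳ (sum-+ h _ _) ⟩
    sum h X + sum h (λ k → X (suc h ℕ.+ (h ∸ suc k))) + X h
      ≈⟨ solve 3 (λ a b c → a :+ b :+ c := a :+ c :+ b) refl _ _ _ ⟩
    sum (suc h) X + sum h (λ k → X (suc h ℕ.+ (h ∸ suc k)))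
      ≈⟨ sum-fold (suc h) h X ⟨
    sum (suc h ℕ.+ h) X
      ≡⟨ ≡.cong (λ n → sum n X) (≡.trans N≡1+2h (≡.cong (λ n → suc (h ℕ.+ n)) (ℕₚ.+-identityʳ h))) ⟨
    sum N X
      ≈⟨ rhs-weight i ⟨
    rhs R q (suc i) N ∎
    where
    X : ℕ → Carrier
    X k = weight i k * alpha R q k
    double : suc (suc (2 ℕ.* h)) ≡ 2 ℕ.* suc h
    double = ℕ-solve (h ∷ [])
    middle : column h (suc h ∸ h) ≈ alpha R q h
    middle = trans (reflexive (≡.cong (column h) (≡.trans (ℕₚ.+-∸-assoc 1 (ℕₚ.≤-refl {h})) (≡.cong suc (ℕₚ.n∸n≡0 h)))))
      (column-middle h N≡1+2h)
    term : ∀ k → (∃ λ o → suc k ℕ.+ o ≡ h) → weight i k * column k (suc h ∸ k) ≈ X k + X (suc h ℕ.+ (h ∸ suc k))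
    term k (L , ≡.refl) = begin
      weight i k * column k (suc (suc k ℕ.+ L) ∸ k)          ≡⟨ ≡.cong (λ l → weight i k * column k l) index₁ ⟩
      weight i k * column k (suc (suc L))                    ≈⟨ fold-pair i k (suc L) (suc (L ℕ.+ L)) (≡.trans N≡1+2h index₂) lower upper ⟩
      X k + X (k ℕ.+ suc (suc (L ℕ.+ L)))                    ≡⟨ ≡.cong (λ l → X k + X l) index₃ ⟩
      X k + X (suc (suc k ℕ.+ L) ℕ.+ L)                      ≡⟨ ≡.cong (λ l → X k + X (suc (suc k ℕ.+ L) ℕ.+ l)) (ℕₚ.m+n∸m≡n (suc k) L) ⟨
      X k + X (suc (suc k ℕ.+ L) ℕ.+ (suc k ℕ.+ L ∸ suc k))  ∎
      where
      regroup : suc (suc k ℕ.+ L) ≡ k ℕ.+ suc (suc L)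
      regroup = ℕ-solve (k ∷ L ∷ [])
      index₁ : suc (suc k ℕ.+ L) ∸ k ≡ suc (suc L)
      index₁ = ≡.trans (≡.cong (_∸ k) regroup) (ℕₚ.m+n∸m≡n k (suc (suc L)))
      index₂ : suc (2 ℕ.* (suc k ℕ.+ L)) ≡ suc (2 ℕ.* k ℕ.+ suc (suc (L ℕ.+ L)))
      index₂ = ℕ-solve (k ∷ L ∷ [])
      index₃ : k ℕ.+ suc (suc (L ℕ.+ L)) ≡ suc (suc k ℕ.+ L) ℕ.+ L
      index₃ = ℕ-solve (k ∷ L ∷ [])
      4+2L : suc (suc L) ℕ.+ suc (suc L) ≡ suc (suc (suc (suc (L ℕ.+ L))))
      4+2L = ℕ-solve (L ∷ [])
      lower : suc (suc (L ℕ.+ L)) < suc (suc L) ℕ.+ suc (suc L)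
      lower = ℕₚ.≤-trans (ℕₚ.n≤1+n _) (ℕₚ.≤-reflexive (≡.sym 4+2L))
      upper : suc (suc L) ℕ.+ suc (suc L) ≤ suc (suc (suc (suc (L ℕ.+ L))))
      upper = ℕₚ.≤-reflexive 4+2L

theorem2p7 : ∀ {c ℓ : Level} (R : CommutativeRing c ℓ) →
    IsIntegralDomain R → CharZero R →
    ∀ (p N : ℕ) → 1 ≤ p → 1 ≤ N →
    ∀ (q : CommutativeRing.Carrier R) → IsPrimitiveRoot R N q →
    ∀ (M : ℕ) → N ≤ M →
    CommutativeRing._≈_ R (Htrunc R q (pow R q (N ∸ 1)) p M) (rhs R q p N)
theorem2p7 R domain charZero (suc i) N _ 1≤N q primRoot M N≤M =
  Evaluation.evaluation R domain charZero N 1≤N q primRoot i M N≤M
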